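{- The graph $G$ (defined in the context) is a fastened $\{K_4,K_{2,2,2}\}$-ultrahomogeneous $\{K_4\}_{42}^4\{K_{2,2,2}\}_{21}^3$-graph which is not line-graphical, and its automorphism group $\mathcal A(G)$ satisfies $|\mathcal A(G)|=1008=4|E(G)|$. Moreover, $\mathcal A(G)$ acts transitively on the edges of $G$ with edge stabilizer $\Gamma$ of order 4 (so the edges of $G$ correspond to the left cosets of $\Gamma$ in $\mathcal A(G)$), and acts transitively on the vertices with vertex stabilizer of order 24 (so the vertices correspond to the left cosets of a subgroup of order 24).
   Context: The Fano plane $\mathcal F$ has points $1,\dots,7$ and lines $\{1,2,3\},\{1,4,5\},\{1,6,7\},\{2,4,6\},\{2,5,7\},\{3,4,7\},\{3,5,6\}$. For a point $p$, the three lines through $p$ are $\{p,q,r\}$ for three disjoint pairs $\{q,r\}$ partitioning $\mathcal F\setminus\{p\}$. An ordered pencil through $p$ is a tuple $v=(p,q_ar_a,q_br_b,q_cr_c)$ in which $q_ar_a,q_br_b,q_cr_c$ are these three (unordered) pairs listed in a chosen linear order. The graph $G$ has the 42 ordered pencils as vertices, with $v=(p,q_ar_a,q_br_b,q_cr_c)$ and $v'=(p',q'_ar'_a,q'_br'_b,q'_cr'_c)$ adjacent iff $p\neq p'$ and $|\{q_i,r_i\}\cap\{q'_i,r'_i\}|=1$ for each $i\in\{a,b,c\}$. A copy of $H$ in $G$ is an induced subgraph isomorphic to $H$. For a connected regular graph $H$ and integers $1<m<n$, an $\{H\}_n^m$-graph is a connected graph that (a) is an edge-disjoint union of $n$ induced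 copies of $H$; (b) has exactly $m$ copies of $H$ containing each vertex, no two of which share more than one vertex; (c) has exactly $n$ induced subgraphs isomorphic to $H$. An $\{H_1\}_{n_1}^{m_1}\{H_2\}_{n_2}^{m_2}$-graph ($H_1\ne H_2$) is one that is both an $\{H_1\}_{n_1}^{m_1}$-graph and an $\{H_2\}_{n_2}^{m_2}$-graph. It is $\{H_1,H_2\}$-ultrahomogeneous if for each $i=1,2$ every isomorphism between two copies of $H_i$ in it extends to an automorphism of the whole graph. It is fastened if each edge lies in exactly one copy of $H_1$ and exactly one copy of $H_2$. It is line-graphical if $\min(m_1,m_2)=m_1=2$ and $H_1$ is a complete graph. -}

module Defs where

open import Data.Nat using (ℕ; _<_; _⊓_; _*_)
import Data.Nat as ℕ
open import Data.Bool using (Bool)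
import Data.Bool as B
open import Data.Fin using (Fin; #_)
open import Data.Fin.Subset using (Subset; ⁅_⁆; _∪_; _∩_; ∣_∣)
open import Data.Vec.Properties using (≡-dec)
open import Data.List using (List; _∷_; [])
open import Data.List.Relation.Unary.Any using (Any; any?)
open import Data.Product using (Σ; ∃; _×_; _,_; proj₁; proj₂)
open import Data.Product.Properties using () renaming (≡-dec to ×-≡-dec)
open import Data.Sum using (_⊎_)
open import Relation.Binary.PropositionalEquality using (_≡_; _≢_)
open import Relation.Nullary using (¬_; Dec; ¬?)
open import Relation.Nullary.Decidable using (True; _×-dec_)
open import Relation.Binary.Construct.Closure.ReflexiveTransitive using (Star)

-- The Fano plane.  Paper's point k (1 ≤ k ≤ 7) is  # (k - 1) : Fin 7.

tri : Fin 7 → Fin 7 → Fin 7 → Subset 7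
tri x y z = ⁅ x ⁆ ∪ (⁅ y ⁆ ∪ ⁅ z ⁆)

fanoLines : List (Subset 7)
fanoLines =
  tri (# 0) (# 1) (# 2) ∷ tri (# 0) (# 3) (# 4) ∷ tri (# 0) (# 5) (# 6) ∷
  tri (# 1) (# 3) (# 5) ∷ tri (# 1) (# 4) (# 6) ∷ tri (# 2) (# 3) (# 6) ∷
  tri (# 2) (# 4) (# 5) ∷ []

_≟ₛ_ : (x y : Subset 7) → Dec (x ≡ y)
_≟ₛ_ = ≡-dec B._≟_

IsLine : Subset 7 → Set
IsLine L = Any (L ≡_) fanoLines

isLine? : (L : Subset 7) → Dec (IsLine L)
isLine? L = any? (L ≟ₛ_) fanoLines

PairThrough : Fin 7 → Subset 7 → Set
PairThrough p s = (∣ s ∣ ≡ 2) × IsLine (⁅ p ⁆ ∪ s)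

pairThrough? : (p : Fin 7) (s : Subset 7) → Dec (PairThrough p s)
pairThrough? p s = (∣ s ∣ ℕ.≟ 2) ×-dec isLine? (⁅ p ⁆ ∪ s)

ValidPencil : Fin 7 → Subset 7 → Subset 7 → Subset 7 → Set
ValidPencil p a b c =
  PairThrough p a × PairThrough p b × PairThrough p c ×
  (a ≢ b) × (a ≢ c) × (b ≢ c)

validPencil? : ∀ p a b c → Dec (ValidPencil p a b c)
validPencil? p a b c =
  pairThrough? p a ×-dec pairThrough? p b ×-dec pairThrough? p c ×-dec
  ¬? (a ≟ₛ b) ×-dec ¬? (a ≟ₛ c) ×-dec ¬? (b ≟ₛ c)

record Pencil : Set where
  constructor pencil
  field
    pt : Fin 7
    pa pb pc : Subset 7
    valid : True (validPencil? pt pa pb pc)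
open Pencil public

_~_ : Pencil → Pencil → Set
v ~ w = (pt v ≢ pt w) × (∣ pa v ∩ pa w ∣ ≡ 1) × (∣ pb v ∩ pb w ∣ ≡ 1)
        × (∣ pc v ∩ pc w ∣ ≡ 1)

record Graph : Set₁ where
  field
    V : Set
    E : V → V → Set
open Graph public

G : Graph
G = record { V = Pencil ; E = _~_ }

K4 : Graph
K4 = record { V = Fin 4 ; E = λ i j → i ≢ j }

K222 : Graph
K222 = record { V = Fin 3 × Fin 2 ; E = λ x y → proj₁ x ≢ proj₁ y }

HasCard : (A : Set) → (A → A → Set) → ℕ → Set
HasCard A _≈_ n = Σ (Fin n → A) λ f →
  (∀ i j → f i ≈ f j → i ≡ j) × (∀ x → ∃ λ i → x ≈ f i)

module _ (Γ : Graph) where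
  private
    W = V Γ
    _⟶_ = E Γ

  Connected : Set
  Connected = ∀ u w → Star _⟶_ u w

  Regular : Set
  Regular = ∃ λ d → ∀ x →
    HasCard (Σ W λ y → x ⟶ y) (λ s t → proj₁ s ≡ proj₁ t) d

  Complete : Set
  Complete = ∀ x y → x ≢ y → x ⟶ y

  Edge : Set
  Edge = Σ (W × W) λ uw → proj₁ uw ⟶ proj₂ uw

  SameEdge : Edge → Edge → Set
  SameEdge ((u , w) , _) ((u' , w') , _) =
    (u ≡ u' × w ≡ w') ⊎ (u ≡ w' × w ≡ u')

  Aut : Set
  Aut = Σ (W → W) λ α →
    (∀ x y → α x ≡ α y → x ≡ y) × (∀ y → ∃ λ x → α x ≡ y) ×
    (∀ x y → (x ⟶ y → α x ⟶ α y) × (α x ⟶ α y → x ⟶ y))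

  _≈Aut_ : Aut → Aut → Set
  α ≈Aut β = ∀ x → proj₁ α x ≡ proj₁ β x

  mapEdge : Aut → Edge → Edge
  mapEdge (α , _ , _ , hom) ((u , w) , e) = (α u , α w) , proj₁ (hom u w) e

  EdgeTransitive : Set
  EdgeTransitive = ∀ e e' → ∃ λ (α : Aut) → SameEdge (mapEdge α e) e'

  VertexTransitive : Set
  VertexTransitive = ∀ u w → ∃ λ (α : Aut) → proj₁ α u ≡ w

  EdgeStabilizer : Edge → Set
  EdgeStabilizer e = Σ Aut λ α → SameEdge (mapEdge α e) e

  VertexStabilizer : W → Set
  VertexStabilizer v = Σ Aut λ α → proj₁ α v ≡ v

module _ (H Γ : Graph) where
  private
    W = V Γ
    _⟶_ = E Γ

  -- an induced embedding of H into Γ; its image is an induced copy of H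
  Emb : Set
  Emb = Σ (V H → W) λ f →
    (∀ x y → f x ≡ f y → x ≡ y) ×
    (∀ x y → (E H x y → f x ⟶ f y) × (f x ⟶ f y → E H x y))

  InCopy : Emb → W → Set
  InCopy f v = ∃ λ x → proj₁ f x ≡ v

  SameCopy : Emb → Emb → Set
  SameCopy f g = (∀ x → InCopy g (proj₁ f x)) × (∀ y → InCopy f (proj₁ g y))

  NumCopies : ℕ → Set
  NumCopies n = HasCard Emb SameCopy n

  NumCopiesAt : W → ℕ → Set
  NumCopiesAt v m = HasCard (Σ Emb λ f → InCopy f v)
                            (λ s t → SameCopy (proj₁ s) (proj₁ t)) m

  NumCopiesAtEdge : W → W → ℕ → Set
  NumCopiesAtEdge u w k = HasCard (Σ Emb λ f → InCopy f u × InCopy f w)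
                            (λ s t → SameCopy (proj₁ s) (proj₁ t)) k

  EdgeDisjointUnion : ℕ → Set
  EdgeDisjointUnion n = Σ (Fin n → Emb) λ c →
    (∀ i j → SameCopy (c i) (c j) → i ≡ j) ×
    (∀ v → ∃ λ i → InCopy (c i) v) ×
    (∀ u w → u ⟶ w →
       ∃ λ i → (InCopy (c i) u × InCopy (c i) w) ×
               (∀ j → InCopy (c j) u → InCopy (c j) w → j ≡ i))

  CopiesMeetOnce : Set
  CopiesMeetOnce = ∀ v (f g : Emb) → InCopy f v → InCopy g v →
    ¬ SameCopy f g → ∀ u → InCopy f u → InCopy g u → u ≡ v

  IsHGraph : ℕ → ℕ → Set
  IsHGraph n m =
    Connected H × Regular H × 1 < m × m < n ×
    Connected Γ ×
    EdgeDisjointUnion n ×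
    (∀ v → NumCopiesAt v m) ×
    CopiesMeetOnce ×
    NumCopies n

  -- every isomorphism between two copies of H extends to an automorphism;
  -- an isomorphism between the copies im f and im g is exactly a map
  -- f x ↦ g x for two induced embeddings f, g of H.
  Ultrahomogeneous : Set
  Ultrahomogeneous = ∀ (f g : Emb) →
    ∃ λ (α : Aut Γ) → ∀ x → proj₁ α (proj₁ f x) ≡ proj₁ g x

Fastened : Graph → Graph → Graph → Set
Fastened H₁ H₂ Γ = ∀ u w → E Γ u w →
  NumCopiesAtEdge H₁ Γ u w 1 × NumCopiesAtEdge H₂ Γ u w 1

LineGraphical : Graph → ℕ → ℕ → Set
LineGraphical H₁ m₁ m₂ = (m₁ ⊓ m₂ ≡ m₁) × (m₁ ≡ 2) × Complete H₁

{-# OPTIONS --safe #-}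
module Submission where

open import Defs
open import Data.Nat using (ℕ; suc; _*_; _<_)
import Data.Nat as ℕ
open import Data.Nat.DivMod using (_mod_)
open import Data.Bool using (Bool; true; false; T; _∧_; not; if_then_else_)
import Data.Bool as B
import Data.Bool.Properties as B
open import Data.Fin as F using (Fin; zero; suc; toℕ; #_; combine; remQuot; punchIn; punchOut)
open import Data.Fin.Properties as F using (all?; any?; combine-remQuot; remQuot-combine)
open import Data.Fin.Permutation.Components using (transpose; transpose-inverse)
open import Data.Fin.Subset using (Subset; ⁅_⁆; _∪_; _∩_; ∣_∣)
open import Data.Vec using (Vec; lookup; []; _∷_)
open import Data.List using (List; []; _∷_; _++_; foldr; replicate; concat)
open import Data.Product as Product using (∃; _×_; _,_; proj₁; proj₂; uncurry; curry)
open import Data.Product.Properties as × using ()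
open import Data.Sum as Sum using (_⊎_; inj₁; inj₂)
open import Data.Empty using (⊥-elim)
open import Data.Unit using (tt)
open import Function using (_∘_; id)
open import Relation.Nullary using (¬_; Dec; yes; no; does; ¬?; contradiction)
open import Relation.Nullary.Decidable
  using (toWitness; fromWitness; map′; T?; _×-dec_; _⊎-dec_; _→-dec_)
open import Relation.Unary using (Decidable)
open import Relation.Binary.PropositionalEquality
open import Relation.Binary.Construct.Closure.ReflexiveTransitive
  using (Star; ε; _◅_; gmap)

-- Collineations of the Fano plane and permutations of the three positions of a pencil act
-- on G.  Among them, a Singer cycle and the position permutations form a group acting
-- regularly on the 42 vertices, and the stabiliser of a vertex v₀ contains a copy of S₄.
-- Listing the ordered tetrahedra and the labelled octahedra based at v₀ shows that these
-- 24 elements act transitively on both lists, so that the 1008 = 42 · 24 products act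
-- transitively on all embeddings of K₄ and of K₂,₂,₂: this is ultrahomogeneity.  An
-- automorphism fixing a tetrahedron pointwise is the identity, so there are no other
-- automorphisms, and all stabilisers can be read off from the action on tetrahedra.  The
-- counts of copies reduce, by transitivity, to inspection of the copies through v₀.

-- Cardinalities

HasCard-Fin : ∀ n → HasCard (Fin n) _≡_ n
HasCard-Fin n = id , (λ _ _ eq → eq) , λ i → i , refl

HasCard-× : ∀ {A B m n} → HasCard A _≡_ m → HasCard B _≡_ n →
  HasCard (A × B) _≡_ (m * n)
HasCard-× {A} {B} {m} {n} (f , f-inj , f-sur) (g , g-inj , g-sur) = h , h-inj , h-sur
  where
  h : Fin (m * n) → A × B
  h = Product.map f g ∘ remQuot n

  h-inj : ∀ i j → h i ≡ h j → i ≡ j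
  h-inj i j eq = trans (sym (combine-remQuot {m} n i)) (trans
    (cong₂ combine (f-inj _ _ (cong proj₁ eq)) (g-inj _ _ (cong proj₂ eq)))
    (combine-remQuot {m} n j))

  h-sur : ∀ x → ∃ λ i → x ≡ h i
  h-sur (x , y) with i , refl ← f-sur x | j , refl ← g-sur y =
    combine i j , cong (Product.map f g) (sym (remQuot-combine i j))

-- Counts classes by a system of representatives `c`, so that copies, edges and automorphisms can be
-- counted up to the relations that identify them.
HasCard-image : ∀ {I A : Set} (_≈_ : A → A → Set) {n} → HasCard I _≡_ n →
  (c : I → A) → (∀ i j → c i ≈ c j → i ≡ j) → (∀ x → ∃ λ i → x ≈ c i) →
  HasCard A _≈_ n
HasCard-image _≈_ (f , f-inj , f-sur) c c-inj c-sur =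
  c ∘ f , (λ i j eq → f-inj i j (c-inj _ _ eq)) ,
  λ x → let (i , x≈ci) = c-sur x ; (k , i≡fk) = f-sur i in
    k , subst (λ j → x ≈ c j) i≡fk x≈ci

-- Automorphisms and embeddings

module _ {Γ : Graph} where

  infixr 9 _∘ᵃ_

  _∘ᵃ_ : Aut Γ → Aut Γ → Aut Γ
  (α , α-inj , α-sur , α-hom) ∘ᵃ (β , β-inj , β-sur , β-hom) =
    α ∘ β ,
    (λ x y eq → β-inj x y (α-inj _ _ eq)) ,
    (λ z → let (y , αy≡z) = α-sur z ; (x , βx≡y) = β-sur y in
      x , trans (cong α βx≡y) αy≡z) ,
    λ x y → proj₁ (α-hom _ _) ∘ proj₁ (β-hom x y) ,
            proj₂ (β-hom x y) ∘ proj₂ (α-hom _ _)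

  inverse : Aut Γ → Aut Γ
  inverse (α , α-inj , α-sur , α-hom) =
    β ,
    (λ x y eq → trans (sym (αβ x)) (trans (cong α eq) (αβ y))) ,
    (λ x → α x , α-inj _ _ (αβ (α x))) ,
    λ x y → (λ e → proj₂ (α-hom _ _) (subst₂ (E Γ) (sym (αβ x)) (sym (αβ y)) e)) ,
            (λ e → subst₂ (E Γ) (αβ x) (αβ y) (proj₁ (α-hom _ _) e))
    where
    β : V Γ → V Γ
    β = proj₁ ∘ α-sur

    αβ : ∀ y → α (β y) ≡ y
    αβ = proj₂ ∘ α-sur

  inverseʳ : ∀ (α : Aut Γ) y → proj₁ α (proj₁ (inverse α) y) ≡ y
  inverseʳ (_ , _ , α-sur , _) = proj₂ ∘ α-sur

  inverseˡ : ∀ (α : Aut Γ) x → proj₁ (inverse α) (proj₁ α x) ≡ x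
  inverseˡ α@(_ , α-inj , _) x = α-inj _ _ (inverseʳ α _)

  inverse-unique : ∀ (α : Aut Γ) {x y} → proj₁ α x ≡ y → proj₁ (inverse α) y ≡ x
  inverse-unique α refl = inverseˡ α _

  -- An involution is its own inverse, so bijectivity and the reflection of edges both come from
  -- `ππ` and `π-hom`.
  involutionAut : (π : V Γ → V Γ) → (∀ x → π (π x) ≡ x) →
    (∀ x y → E Γ x y → E Γ (π x) (π y)) → Aut Γ
  involutionAut π ππ π-hom =
    π ,
    (λ x y eq → trans (sym (ππ x)) (trans (cong π eq) (ππ y))) ,
    (λ y → π y , ππ y) ,
    λ x y → π-hom x y , λ e → subst₂ (E Γ) (ππ x) (ππ y) (π-hom _ _ e)

-- Maps with the same image

infix 4 _≋_

-- `SameCopy` on the underlying maps, usable for codes as well as for vertices of a graph.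
_≋_ : {A B : Set} → (A → B) → (A → B) → Set
f ≋ g = (∀ x → ∃ λ y → g y ≡ f x) × (∀ y → ∃ λ x → f x ≡ g y)

module _ {A B : Set} where

  ≋-sym : {f g : A → B} → f ≋ g → g ≋ f
  ≋-sym = Product.swap

  ≋-image : {f g : A → B} → f ≋ g → ∀ {v} → (∃ λ x → f x ≡ v) → ∃ λ y → g y ≡ v
  ≋-image (f⊆g , _) (x , refl) = f⊆g x

  ≋-trans : {f g h : A → B} → f ≋ g → g ≋ h → f ≋ h
  ≋-trans fg gh =
    (λ x → ≋-image gh (proj₁ fg x)) , (λ z → ≋-image (≋-sym fg) (proj₂ gh z))

  ≋-injective : {C : Set} {α : B → C} → (∀ u v → α u ≡ α v → u ≡ v) →
    {f g : A → B} → (α ∘ f) ≋ (α ∘ g) → f ≋ g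
  ≋-injective α-inj (f⊆g , g⊆f) =
    Product.map₂ (α-inj _ _) ∘ f⊆g , Product.map₂ (α-inj _ _) ∘ g⊆f

  ≗⇒≋ : {f g : A → B} → f ≗ g → f ≋ g
  ≗⇒≋ f≗g = (λ x → x , sym (f≗g x)) , (λ x → x , f≗g x)

  ≋-cong : {C : Set} (α : B → C) {f g : A → B} → f ≋ g → (α ∘ f) ≋ (α ∘ g)
  ≋-cong α (f⊆g , g⊆f) = Product.map₂ (cong α) ∘ f⊆g , Product.map₂ (cong α) ∘ g⊆f

module _ (H Γ : Graph) where

  compose : Aut Γ → Emb H Γ → Emb H Γ
  compose (α , α-inj , _ , α-hom) (f , f-inj , f-hom) =
    α ∘ f , (λ x y eq → f-inj x y (α-inj _ _ eq)) ,
    λ x y → proj₁ (α-hom _ _) ∘ proj₁ (f-hom x y) ,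
            proj₂ (f-hom x y) ∘ proj₂ (α-hom _ _)

  reparametrise : Emb H Γ → Aut H → Emb H Γ
  reparametrise (f , f-inj , f-hom) (π , π-inj , _ , π-hom) =
    f ∘ π , (λ x y eq → π-inj x y (f-inj _ _ eq)) ,
    λ x y → proj₁ (f-hom _ _) ∘ proj₁ (π-hom x y) ,
            proj₂ (π-hom x y) ∘ proj₂ (f-hom _ _)

  reparametrise-≋ : ∀ f π → SameCopy H Γ (reparametrise f π) f
  reparametrise-≋ (f , _) (π , _ , π-sur , _) =
    (λ x → π x , refl) , λ y → Product.map₂ (cong f) (π-sur y)

-- Copies of H in a vertex-transitive graph, from the copies through one vertex v₀

module Copies
  (H Γ : Graph)
  (_≟_ : (u v : V Γ) → Dec (u ≡ v))
  (loopless : ∀ v → ¬ E Γ v v)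
  (h₀ h₁ : V H) (h₁≢h₀ : h₁ ≢ h₀)
  (rebase : ∀ x → ∃ λ (π : Aut H) → proj₁ π h₀ ≡ x)
  (v₀ : V Γ)
  (transport : ∀ v → ∃ λ (α : Aut Γ) → proj₁ α v₀ ≡ v)
  {m : ℕ} (r : Fin (suc m) → Emb H Γ)
  (r-h₀ : ∀ j → proj₁ (r j) h₀ ≡ v₀)
  (r-complete : ∀ f → proj₁ f h₀ ≡ v₀ → ∃ λ j → SameCopy H Γ f (r j))
  (r-meet : ∀ i j x y → proj₁ (r i) x ≡ proj₁ (r j) y → i ≡ j ⊎ proj₁ (r i) x ≡ v₀)
  (r-neighbour : ∀ w → E Γ v₀ w → ∃ λ j → InCopy H Γ (r j) w)
  where

  copyAt : V Γ → Fin (suc m) → Emb H Γ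
  copyAt v j = compose H Γ (proj₁ (transport v)) (r j)

  copyAt-h₀ : ∀ v j → proj₁ (copyAt v j) h₀ ≡ v
  copyAt-h₀ v j = trans (cong (proj₁ (proj₁ (transport v))) (r-h₀ j)) (proj₂ (transport v))

  -- The automorphism `π` of `H` makes `h₀` the vertex of the copy that lies at `v`; pulled back
  -- along `transport v`, the copy is based at `v₀`, where the list `r` is complete.
  copyAt-complete : ∀ v f → InCopy H Γ f v → ∃ λ j → SameCopy H Γ f (copyAt v j)
  copyAt-complete v f (x , fx≡v) =
    let (α , αv₀≡v) = transport v
        (π , πh₀≡x) = rebase x
        g = compose H Γ (inverse α) (reparametrise H Γ f π)
        gh₀≡v₀ = inverse-unique α (trans αv₀≡v (sym (trans (cong (proj₁ f) πh₀≡x) fx≡v)))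
        (j , g≈rj) = r-complete g gh₀≡v₀
    in j , ≋-trans (≋-sym (reparametrise-≋ H Γ f π))
             (≋-trans (≗⇒≋ λ y → sym (inverseʳ α _)) (≋-cong (proj₁ α) g≈rj))

  copyAt-meet : ∀ v i j u → u ≢ v →
    InCopy H Γ (copyAt v i) u → InCopy H Γ (copyAt v j) u → i ≡ j
  copyAt-meet v i j u u≢v (x , p) (y , q) with transport v
  ... | (α , α-inj , _) , αv₀≡v with r-meet i j x y (α-inj _ _ (trans p (sym q)))
  ... | inj₁ i≡j = i≡j
  ... | inj₂ rx≡v₀ = contradiction (trans (sym p) (trans (cong α rx≡v₀) αv₀≡v)) u≢v

  -- Equal copies share the image of `h₁`, a vertex other than `v`, and `copyAt-meet` applies to it.
  copyAt-injective : ∀ v i j → SameCopy H Γ (copyAt v i) (copyAt v j) → i ≡ j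
  copyAt-injective v i j (i⊆j , _) = copyAt-meet v i j _
    (λ h₁↦v → h₁≢h₀ (proj₁ (proj₂ (copyAt v i)) _ _ (trans h₁↦v (sym (copyAt-h₀ v i)))))
    (h₁ , refl) (i⊆j h₁)

  -- Both copies occur in the list at `v`, and listed copies with a common vertex besides `v` have
  -- the same index. Edge-disjointness and the uniqueness of the copy on an edge rest on this.
  meet : ∀ f g u v → u ≢ v → InCopy H Γ f v → InCopy H Γ g v →
    InCopy H Γ f u → InCopy H Γ g u → SameCopy H Γ f g
  meet f g u v u≢v fv gv fu gu
    with i , f≈i ← copyAt-complete v f fv | j , g≈j ← copyAt-complete v g gv
    with refl ← copyAt-meet v i j u u≢v (≋-image f≈i fu)
                                        (≋-image g≈j gu) =
    ≋-trans f≈i (≋-sym g≈j)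

  numCopiesAt : ∀ v → NumCopiesAt H Γ v (suc m)
  numCopiesAt v =
    (λ j → copyAt v j , h₀ , copyAt-h₀ v j) , copyAt-injective v ,
    λ (f , fv) → copyAt-complete v f fv

  copiesMeetOnce : CopiesMeetOnce H Γ
  copiesMeetOnce v f g fv gv f≉g u fu gu with u ≟ v
  ... | yes u≡v = u≡v
  ... | no u≢v = contradiction (meet f g u v u≢v fv gv fu gu) f≉g

  copyOnEdge : ∀ u w → E Γ u w → ∃ λ f → InCopy H Γ f u × InCopy H Γ f w
  copyOnEdge u w uw =
    let (α , αv₀≡u) = transport u
        (j , x , rx≡w′) = r-neighbour (proj₁ (inverse α) w)
          (subst (λ v → E Γ v (proj₁ (inverse α) w)) (inverse-unique α αv₀≡u)
            (proj₁ (proj₂ (proj₂ (proj₂ (inverse α))) u w) uw))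
    in copyAt u j , (h₀ , copyAt-h₀ u j) , x , trans (cong (proj₁ α) rx≡w′) (inverseʳ α w)

  edge⇒≢ : ∀ {u w} → E Γ u w → u ≢ w
  edge⇒≢ uu refl = loopless _ uu

  numCopiesAtEdge : ∀ u w → E Γ u w → NumCopiesAtEdge H Γ u w 1
  numCopiesAtEdge u w uw =
    let (f , fu , fw) = copyOnEdge u w uw in
    (λ _ → f , fu , fw) , (λ { zero zero _ → refl }) ,
    λ (g , gu , gw) → zero , meet g f u w (edge⇒≢ uw) gw fw gu fu

  module Enumeration
    {I : Set} {n : ℕ} (I-card : HasCard I _≡_ n)
    (c : I → Emb H Γ)
    (c-injective : ∀ i j → SameCopy H Γ (c i) (c j) → i ≡ j)
    (c-complete : ∀ v j → ∃ λ i → SameCopy H Γ (copyAt v j) (c i))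
    where

    -- Every copy passes through its image of `h₀`, so it is some `copyAt v j`, and `c-complete`
    -- matches these with the list `c`.
    numCopies : NumCopies H Γ n
    numCopies = HasCard-image (SameCopy H Γ) I-card c c-injective λ f →
      let (j , f≈j) = copyAt-complete (proj₁ f h₀) f (h₀ , refl)
          (i , j≈i) = c-complete (proj₁ f h₀) j
      in i , ≋-trans f≈j j≈i

    edgeDisjointUnion : EdgeDisjointUnion H Γ n
    edgeDisjointUnion =
      let (d , d-inj , d-sur) = numCopies in
      d , d-inj ,
      (λ v → let (i , s) = d-sur (copyAt v zero) in
        i , ≋-image s (h₀ , copyAt-h₀ v zero)) ,
      λ u w uw →
        let (f , fu , fw) = copyOnEdge u w uw
            (i , s) = d-sur f
            iu = ≋-image s fu
            iw = ≋-image s fw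
        in i , (iu , iw) ,
           λ j ju jw → d-inj j i (meet (d j) (d i) u w (edge⇒≢ uw) jw iw ju iu)

    isHGraph : Connected H → Regular H → 1 < suc m → suc m < n → Connected Γ →
      IsHGraph H Γ n (suc m)
    isHGraph H-conn H-reg 1<m m<n Γ-conn =
      H-conn , H-reg , 1<m , m<n , Γ-conn ,
      edgeDisjointUnion , numCopiesAt , copiesMeetOnce , numCopies

-- The coordinate model.  Labelling the points of the Fano plane by ℤ/7 through
-- the Singer cycle, its lines are the translates of the difference set {0,1,3};
-- the line joining p and q has a "type" in ℤ/3 at p, which depends on q − p only.
-- A pencil at p is a bijection from types to positions, that is, one of the maps
-- x ↦ k + x and x ↦ k − x of ℤ/3.  Two pencils at different points p, q are
-- adjacent iff they put the line pq at the same position.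

infixl 6 _⊕_ _⊖_

-- Arithmetic modulo `suc n`; the monus does not truncate, as `toℕ j` is at most `n`.
_⊕_ _⊖_ : ∀ {n} → Fin (suc n) → Fin (suc n) → Fin (suc n)
_⊕_ {n} i j = (toℕ i ℕ.+ toℕ j) mod suc n
_⊖_ {n} i j = (toℕ i ℕ.+ (suc n ℕ.∸ toℕ j)) mod suc n

Code : Set
Code = Fin 7 × Fin 3 × Fin 2

_≟ᶜ_ : (u w : Code) → Dec (u ≡ w)
_≟ᶜ_ = ×.≡-dec F._≟_ (×.≡-dec F._≟_ F._≟_)

all×? : ∀ {A B : Set} →
  (∀ {P : A → Set} → Decidable P → Dec (∀ x → P x)) →
  (∀ {P : B → Set} → Decidable P → Dec (∀ x → P x)) →
  ∀ {P : A × B → Set} → Decidable P → Dec (∀ x → P x)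
all×? ∀A ∀B P? = map′ uncurry curry (∀A λ x → ∀B λ y → P? (x , y))

any×? : ∀ {A B : Set} →
  (∀ {P : A → Set} → Decidable P → Dec (∃ P)) →
  (∀ {P : B → Set} → Decidable P → Dec (∃ P)) →
  ∀ {P : A × B → Set} → Decidable P → Dec (∃ P)
any×? ∃A ∃B P? = map′ (λ (x , y , p) → (x , y) , p) (λ ((x , y) , p) → x , y , p)
  (∃A λ x → ∃B λ y → P? (x , y))

allᶜ? : ∀ {P : Code → Set} → Decidable P → Dec (∀ c → P c)
allᶜ? = all×? all? (all×? all? all?)

anyᶜ? : ∀ {P : Code → Set} → Decidable P → Dec (∃ P)
anyᶜ? = any×? any? (any×? any? any?)

-- The lines through 0 are {0,1,3}, {0,2,6} and {0,4,5}: the one of type x contains the square 2ˣ,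
-- its representative, and the nonsquare 3·2ˣ, its third point.
representative : Fin 3 → Fin 7
representative = lookup (# 1 ∷ # 2 ∷ # 4 ∷ [])

third : Fin 3 → Fin 7
third = lookup (# 3 ∷ # 6 ∷ # 5 ∷ [])

-- The value at 0 is junk.
type : Fin 7 → Fin 3
type = lookup (# 0 ∷ # 0 ∷ # 1 ∷ # 0 ∷ # 2 ∷ # 2 ∷ # 1 ∷ [])

position : Fin 3 → Fin 2 → Fin 3 → Fin 3
position k zero x = k ⊕ x
position k (suc zero) x = k ⊖ x

-- The inverse of `position k e`.
typeAt : Fin 3 → Fin 2 → Fin 3 → Fin 3
typeAt k zero n = n ⊖ k
typeAt k (suc zero) n = k ⊖ n

adj : Code → Code → Bool
adj (i , k , e) (j , l , f) =
  not (does (i F.≟ j)) ∧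
  does (position k e (type (j ⊖ i)) F.≟ position l f (type (i ⊖ j)))

-- A bijection carrying the translates of {0,1,3} to `fanoLines`.
label : Fin 7 → Fin 7
label = lookup (# 0 ∷ # 1 ∷ # 3 ∷ # 2 ∷ # 5 ∷ # 6 ∷ # 4 ∷ [])

pair : Fin 7 → Fin 3 → Subset 7
pair i x = ⁅ label (i ⊕ representative x) ⁆ ∪ ⁅ label (i ⊕ third x) ⁆

pairAt : Code → Fin 3 → Subset 7
pairAt (i , k , e) n = pair i (typeAt k e n)

ValidCode : Code → Set
ValidCode c@(i , _) = ValidPencil (label i) (pairAt c (# 0)) (pairAt c (# 1)) (pairAt c (# 2))

validCode? : Decidable ValidCode
validCode? c@(i , _) = validPencil? (label i) (pairAt c (# 0)) (pairAt c (# 1)) (pairAt c (# 2))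

-- Codes and pencils correspond bijectively

opaque
  validCode : ∀ c → ValidCode c
  validCode = toWitness {a? = allᶜ? validCode?} _

opaque
  decode : Code → Pencil
  decode c@(i , _) = pencil (label i) (pairAt c (# 0)) (pairAt c (# 1)) (pairAt c (# 2))
    (fromWitness {a? = validCode? c} (validCode c))

allVec? : ∀ {n} {P : Vec Bool n → Set} → Decidable P → Dec (∀ v → P v)
allVec? {ℕ.zero} P? = map′ (λ { p [] → p }) (λ p → p []) (P? [])
allVec? {suc n} P? =
  map′ (λ { (p , q) (true ∷ v) → p v ; (p , q) (false ∷ v) → q v })
       (λ p → (λ v → p (true ∷ v)) , (λ v → p (false ∷ v)))
       (allVec? (λ v → P? (true ∷ v)) ×-dec allVec? (λ v → P? (false ∷ v)))

opaque
  pairThrough-pair : ∀ p → ∃ λ i → label i ≡ p ×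
    (∀ s → PairThrough p s → ∃ λ x → pair i x ≡ s)
  pairThrough-pair = toWitness {a? = all? λ p → any? λ i → (label i F.≟ p) ×-dec
    allVec? λ s → pairThrough? p s →-dec any? λ x → pair i x ≟ₛ s} _

opaque
  -- The six maps k + x and k - x are all the permutations of ℤ/3.
  distinct-typeAt : ∀ x y z → x ≢ y → x ≢ z → y ≢ z →
    ∃ λ k → ∃ λ e → typeAt k e (# 0) ≡ x × typeAt k e (# 1) ≡ y × typeAt k e (# 2) ≡ z
  distinct-typeAt = toWitness {a? = all? λ x → all? λ y → all? λ z →
    ¬? (x F.≟ y) →-dec ¬? (x F.≟ z) →-dec ¬? (y F.≟ z) →-dec any? λ k → any? λ e →
    (typeAt k e (# 0) F.≟ x) ×-dec (typeAt k e (# 1) F.≟ y) ×-dec (typeAt k e (# 2) F.≟ z)} _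

pencil-ext : ∀ v w → pt v ≡ pt w → pa v ≡ pa w → pb v ≡ pb w → pc v ≡ pc w → v ≡ w
pencil-ext (pencil p a b c _) (pencil _ _ _ _ _) refl refl refl refl =
  cong (pencil p a b c) (B.T-irrelevant _ _)

validPencil-code : ∀ {p a b c} → ValidPencil p a b c → ∃ λ u → label (proj₁ u) ≡ p ×
  pairAt u (# 0) ≡ a × pairAt u (# 1) ≡ b × pairAt u (# 2) ≡ c
validPencil-code {p} (a-pair , b-pair , c-pair , a≢b , a≢c , b≢c) =
  let (i , i≡p , pairs) = pairThrough-pair p
      (x , x≡a) = pairs _ a-pair
      (y , y≡b) = pairs _ b-pair
      (z , z≡c) = pairs _ c-pair
      (k , e , x≡ , y≡ , z≡) = distinct-typeAt x y z
        (λ x≡y → a≢b (trans (sym x≡a) (trans (cong (pair i) x≡y) y≡b)))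
        (λ x≡z → a≢c (trans (sym x≡a) (trans (cong (pair i) x≡z) z≡c)))
        (λ y≡z → b≢c (trans (sym y≡b) (trans (cong (pair i) y≡z) z≡c)))
  in (i , k , e) , i≡p , trans (cong (pair i) x≡) x≡a ,
     trans (cong (pair i) y≡) y≡b , trans (cong (pair i) z≡) z≡c

opaque
  unfolding decode

  decode-surjective : ∀ v → ∃ λ c → decode c ≡ v
  decode-surjective v =
    let (c , p≡ , a≡ , b≡ , c≡) = validPencil-code
          (toWitness {a? = validPencil? (pt v) (pa v) (pb v) (pc v)} (valid v))
    in c , pencil-ext (decode c) v p≡ a≡ b≡ c≡

encode : Pencil → Code
encode = proj₁ ∘ decode-surjective

decode-encode : ∀ v → decode (encode v) ≡ v
decode-encode = proj₂ ∘ decode-surjective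

Adjacent? : ∀ v w → Dec (v ~ w)
Adjacent? v w = ¬? (pt v F.≟ pt w) ×-dec (∣ pa v ∩ pa w ∣ ℕ.≟ 1) ×-dec
  (∣ pb v ∩ pb w ∣ ℕ.≟ 1) ×-dec (∣ pc v ∩ pc w ∣ ℕ.≟ 1)

opaque
  unfolding decode

  -- Let p and q be the two points. Their pairs on the line pq meet in its third point, pairs on two
  -- other lines meet in one point, and a pair on pq is disjoint from one on another line; so all
  -- three intersections are singletons iff pq has the same position in both pencils.
  decode-adj : ∀ u w → does (Adjacent? (decode u) (decode w)) ≡ adj u w
  decode-adj = toWitness {a? = allᶜ? λ u → allᶜ? λ w → _ B.≟ _} _

decode-injective : ∀ u w → decode u ≡ decode w → u ≡ w
decode-injective u w eq = injective u w (cong pt eq) (cong pa eq) (cong pb eq)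
  where
  opaque
    unfolding decode

    injective : ∀ u w → pt (decode u) ≡ pt (decode w) → pa (decode u) ≡ pa (decode w) →
      pb (decode u) ≡ pb (decode w) → u ≡ w
    injective = toWitness {a? = allᶜ? λ u → allᶜ? λ w →
      (_ F.≟ _) →-dec (_ ≟ₛ _) →-dec (_ ≟ₛ _) →-dec (u ≟ᶜ w)} _

encode-decode : ∀ c → encode (decode c) ≡ c
encode-decode c = decode-injective _ _ (decode-encode (decode c))

encode-injective : ∀ {v w} → encode v ≡ encode w → v ≡ w
encode-injective {v} {w} eq =
  trans (sym (decode-encode v)) (trans (cong decode eq) (decode-encode w))

_≟ᵖ_ : (v w : Pencil) → Dec (v ≡ w)
v ≟ᵖ w = map′ encode-injective (cong encode) (encode v ≟ᶜ encode w)

does-reflects : ∀ {A : Set} {b} (a? : Dec A) → does a? ≡ b → (T b → A) × (A → T b)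
does-reflects (yes a) refl = (λ _ → a) , λ _ → tt
does-reflects (no ¬a) refl = ⊥-elim , ¬a

decode-~ : ∀ u w → (T (adj u w) → decode u ~ decode w) × (decode u ~ decode w → T (adj u w))
decode-~ u w = does-reflects (Adjacent? (decode u) (decode w)) (decode-adj u w)

encode-~ : ∀ v w → (v ~ w → T (adj (encode v) (encode w))) × (T (adj (encode v) (encode w)) → v ~ w)
encode-~ v w =
  (λ vw → proj₂ (decode-~ _ _) (subst₂ _~_ (sym (decode-encode v)) (sym (decode-encode w)) vw)) ,
  (λ t → subst₂ _~_ (decode-encode v) (decode-encode w) (proj₁ (decode-~ _ _) t))

~-irreflexive : ∀ v → ¬ v ~ v
~-irreflexive v (p≢p , _) = p≢p refl

-- Automorphisms of the model

-- κ gives the position of each type; it must be x ↦ k + x or x ↦ k − x.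
code : Fin 7 → (Fin 3 → Fin 3) → Code
code i κ = i , κ (# 0) , (if does (κ (# 1) F.≟ κ (# 0) ⊕ # 1) then # 0 else # 1)

-- The action of an involutive collineation g: the line through g i of type x
-- comes from the line through i and g (g i + representative x).
involution : Vec (Fin 7) 7 → Code → Code
involution g (i , k , e) =
  code j λ x → position k e (type (lookup g (j ⊕ representative x) ⊖ i))
  where j = lookup g i

-- ρ is the Singer cycle, σ and φ permute the positions, and the τs are elations.
data Generator : Set where
  ρ σ φ τ₁ τ₂ τ₃ : Generator

act : Generator → Code → Code
act ρ (i , k , e) = i ⊕ # 1 , k , e
act σ (i , k , e) = i , k ⊕ # 1 , e
act φ (i , k , e) = i , # 0 ⊖ k , # 1 ⊖ e
act τ₁ = involution (# 0 ∷ # 2 ∷ # 1 ∷ # 6 ∷ # 4 ∷ # 5 ∷ # 3 ∷ [])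
act τ₂ = involution (# 0 ∷ # 1 ∷ # 4 ∷ # 3 ∷ # 2 ∷ # 6 ∷ # 5 ∷ [])
act τ₃ = involution (# 0 ∷ # 1 ∷ # 6 ∷ # 3 ∷ # 5 ∷ # 4 ∷ # 2 ∷ [])

allGenerators? : ∀ {P : Generator → Set} → Decidable P → Dec (∀ g → P g)
allGenerators? P? =
  map′ (λ { (p , _) ρ → p ; (_ , p , _) σ → p ; (_ , _ , p , _) φ → p
          ; (_ , _ , _ , p , _) τ₁ → p ; (_ , _ , _ , _ , p , _) τ₂ → p
          ; (_ , _ , _ , _ , _ , p) τ₃ → p })
       (λ p → p ρ , p σ , p φ , p τ₁ , p τ₂ , p τ₃)
       (P? ρ ×-dec P? σ ×-dec P? φ ×-dec P? τ₁ ×-dec P? τ₂ ×-dec P? τ₃)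

-- An edge of position k lies in an octahedron with vertices at the three points of
-- its line; opposite vertices are the two pencils at a point with that line at
-- position k.
opposite : Code → Code → Bool
opposite (i , _ , e) (j , _ , f) = does (i F.≟ j) ∧ not (does (e F.≟ f))

opaque
  -- The exhaustive checks concern the six generators only; words inherit the properties by
  -- induction.
  act-adj : ∀ g u w → adj (act g u) (act g w) ≡ adj u w
  act-adj = toWitness {a? = allGenerators? λ g → allᶜ? λ u → allᶜ? λ w → _ B.≟ _} _

  act-opposite : ∀ g u w → opposite (act g u) (act g w) ≡ opposite u w
  act-opposite = toWitness {a? = allGenerators? λ g → allᶜ? λ u → allᶜ? λ w → _ B.≟ _} _

  act-injective : ∀ g u w → act g u ≡ act g w → u ≡ w
  act-injective = toWitness {a? = allGenerators? λ g → allᶜ? λ u → allᶜ? λ w →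
    (_ ≟ᶜ _) →-dec (_ ≟ᶜ _)} _

  act-surjective : ∀ g w → ∃ λ u → act g u ≡ w
  act-surjective = toWitness {a? = allGenerators? λ g → allᶜ? λ w → anyᶜ? λ u → _ ≟ᶜ _} _

Word : Set
Word = List Generator

⟦_⟧ : Word → Code → Code
⟦ w ⟧ c = foldr act c w

⟦⟧-adj : ∀ w u v → adj (⟦ w ⟧ u) (⟦ w ⟧ v) ≡ adj u v
⟦⟧-adj [] u v = refl
⟦⟧-adj (g ∷ w) u v = trans (act-adj g _ _) (⟦⟧-adj w u v)

⟦⟧-opposite : ∀ w u v → opposite (⟦ w ⟧ u) (⟦ w ⟧ v) ≡ opposite u v
⟦⟧-opposite [] u v = refl
⟦⟧-opposite (g ∷ w) u v = trans (act-opposite g _ _) (⟦⟧-opposite w u v)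

⟦⟧-injective : ∀ w {u v} → ⟦ w ⟧ u ≡ ⟦ w ⟧ v → u ≡ v
⟦⟧-injective [] eq = eq
⟦⟧-injective (g ∷ w) eq = ⟦⟧-injective w (act-injective g _ _ eq)

⟦⟧-surjective : ∀ w v → ∃ λ u → ⟦ w ⟧ u ≡ v
⟦⟧-surjective [] v = v , refl
⟦⟧-surjective (g ∷ w) v =
  let (u , gu≡v) = act-surjective g v ; (t , wt≡u) = ⟦⟧-surjective w u in
  t , trans (cong (act g) wt≡u) gu≡v

automorphism : Word → Aut G
automorphism w =
  (λ v → decode (⟦ w ⟧ (encode v))) ,
  (λ u v eq → encode-injective (⟦⟧-injective w (decode-injective _ _ eq))) ,
  (λ v → let (c , wc≡v) = ⟦⟧-surjective w (encode v) in
    decode c , trans (cong (decode ∘ ⟦ w ⟧) (encode-decode c))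
                     (trans (cong decode wc≡v) (decode-encode v))) ,
  λ u v →
    (λ uv → proj₁ (decode-~ _ _) (subst T (sym (⟦⟧-adj w _ _)) (proj₁ (encode-~ u v) uv))) ,
    (λ e → proj₂ (encode-~ u v) (subst T (⟦⟧-adj w _ _) (proj₂ (decode-~ _ _) e)))

automorphism-decode : ∀ w c → proj₁ (automorphism w) (decode c) ≡ decode (⟦ w ⟧ c)
automorphism-decode w c = cong (decode ∘ ⟦ w ⟧) (encode-decode c)

origin : Code
origin = # 0 , # 0 , # 0

-- The words ρⁱ σᵏ φᵉ act regularly on the vertices.
translation : Code → Word
translation (i , k , e) = replicate (toℕ i) ρ ++ replicate (toℕ k) σ ++ replicate (toℕ e) φ

-- The stabiliser of the origin is a copy of S₄, factored as ⟨ξ⟩⟨μ⟩⟨δ⟩ with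
-- ξ of order 4, μ of order 3 and δ of order 2.  Here μ acts as multiplication
-- by 2 on ℤ/7, and τ₁, τ₂ are followed by the permutation of the positions
-- that makes them fix the origin.
Stabiliser : Set
Stabiliser = Fin 4 × Fin 3 × Fin 2

stabiliser : Stabiliser → Word
stabiliser (a , b , c) = power a (δ ++ τ₃ ∷ []) ++ power b (δ ++ φ ∷ τ₂ ∷ []) ++ power c δ
  where
  δ : Word
  δ = σ ∷ φ ∷ τ₁ ∷ []

  power : ∀ {n} → Fin n → Word → Word
  power k w = concat (replicate (toℕ k) w)

_≟ˢ_ : (s t : Stabiliser) → Dec (s ≡ t)
_≟ˢ_ = ×.≡-dec F._≟_ (×.≡-dec F._≟_ F._≟_)

allˢ? : ∀ {P : Stabiliser → Set} → Decidable P → Dec (∀ s → P s)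
allˢ? = all×? all? (all×? all? all?)

anyˢ? : ∀ {P : Stabiliser → Set} → Decidable P → Dec (∃ P)
anyˢ? = any×? any? (any×? any? any?)

opaque
  translation-origin : ∀ c → ⟦ translation c ⟧ origin ≡ c
  translation-origin = toWitness {a? = allᶜ? λ c → _ ≟ᶜ _} _

  stabiliser-origin : ∀ s → ⟦ stabiliser s ⟧ origin ≡ origin
  stabiliser-origin = toWitness {a? = allˢ? λ s → _ ≟ᶜ _} _

v₀ : Pencil
v₀ = decode origin

translate : ∀ v → ∃ λ (α : Aut G) → proj₁ α v₀ ≡ v
translate v = automorphism (translation (encode v)) ,
  trans (automorphism-decode (translation (encode v)) origin)
        (trans (cong decode (translation-origin (encode v))) (decode-encode v))

opaque
  element : Code × Stabiliser → Aut G
  element (c , s) = automorphism (translation c) ∘ᵃ automorphism (stabiliser s)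

  element-decode : ∀ c s u →
    proj₁ (element (c , s)) (decode u) ≡ decode (⟦ translation c ⟧ (⟦ stabiliser s ⟧ u))
  element-decode c s u =
    trans (cong (proj₁ (automorphism (translation c))) (automorphism-decode (stabiliser s) u))
          (automorphism-decode (translation c) _)

-- Orbits of embeddings

module Model
  (H : Graph) (h₀ : V H) (b : V H → Code)
  (b-h₀ : b h₀ ≡ origin)
  (b-injective : ∀ x y → b x ≡ b y → x ≡ y)
  (b-induced : ∀ x y → (E H x y → T (adj (b x) (b y))) × (T (adj (b x) (b y)) → E H x y))
  (local : ∀ (f : Emb H G) → proj₁ f h₀ ≡ v₀ →
    ∃ λ s → ∀ x → proj₁ f x ≡ decode (⟦ stabiliser s ⟧ (b x)))
  where

  copy : Word → Emb H G
  copy w =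
    (λ x → decode (⟦ w ⟧ (b x))) ,
    (λ x y eq → b-injective x y (⟦⟧-injective w (decode-injective _ _ eq))) ,
    λ x y →
      (λ e → proj₁ (decode-~ _ _) (subst T (sym (⟦⟧-adj w _ _)) (proj₁ (b-induced x y) e))) ,
      (λ e → proj₂ (b-induced x y) (subst T (⟦⟧-adj w _ _) (proj₂ (decode-~ _ _) e)))

  opaque
    unfolding element

    -- Undoing a translation brings the base vertex of `f` to `v₀`, where `local` supplies the
    -- stabilising factor; so all embeddings lie in the orbit of the standard one `b`.
    reach : ∀ (f : Emb H G) → ∃ λ g → ∀ x → proj₁ f x ≡ proj₁ (element g) (decode (b x))
    reach f =
      let v = proj₁ f h₀
          (α , αv₀≡v) = translate v
          (s , eq) = local (compose H G (inverse α) f) (inverse-unique α αv₀≡v)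
      in (encode v , s) , λ x → trans (sym (inverseʳ α _))
           (cong (proj₁ α) (trans (eq x) (sym (automorphism-decode (stabiliser s) (b x)))))

  opaque
    ultrahomogeneous : Ultrahomogeneous H G
    ultrahomogeneous f g =
      let (i , f≗) = reach f ; (j , g≗) = reach g in
      element j ∘ᵃ inverse (element i) ,
      λ x → trans (cong (proj₁ (element j)) (inverse-unique (element i) (sym (f≗ x)))) (sym (g≗ x))

  -- The images of the standard copy under the elements `κ` represent the copies through the origin;
  -- its images under the translations `ι` represent all copies.
  module Counting
    (h₁ : V H) (h₁≢h₀ : h₁ ≢ h₀)
    (rebase : ∀ x → ∃ λ (π : Aut H) → proj₁ π h₀ ≡ x)
    {m : ℕ} (κ : Fin (suc m) → Stabiliser)
    (κ-complete : ∀ s → ∃ λ j → (⟦ stabiliser s ⟧ ∘ b) ≋ (⟦ stabiliser (κ j) ⟧ ∘ b))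
    (κ-meet : ∀ i j x y → ⟦ stabiliser (κ i) ⟧ (b x) ≡ ⟦ stabiliser (κ j) ⟧ (b y) →
      i ≡ j ⊎ ⟦ stabiliser (κ i) ⟧ (b x) ≡ origin)
    (κ-neighbour : ∀ w → T (adj origin w) → ∃ λ j → ∃ λ x → ⟦ stabiliser (κ j) ⟧ (b x) ≡ w)
    {I : Set} {n : ℕ} (I-card : HasCard I _≡_ n) (ι : I → Code)
    (ι-distinct : ∀ i j → (⟦ translation (ι i) ⟧ ∘ b) ≋ (⟦ translation (ι j) ⟧ ∘ b) → i ≡ j)
    (ι-complete : ∀ c j → ∃ λ i →
      (⟦ translation c ⟧ ∘ ⟦ stabiliser (κ j) ⟧ ∘ b) ≋ (⟦ translation (ι i) ⟧ ∘ b))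
    where

    local-copy : Fin (suc m) → Emb H G
    local-copy = copy ∘ stabiliser ∘ κ

    local-h₀ : ∀ j → proj₁ (local-copy j) h₀ ≡ v₀
    local-h₀ j = cong decode (trans (cong ⟦ stabiliser (κ j) ⟧ b-h₀) (stabiliser-origin (κ j)))

    local-complete : ∀ f → proj₁ f h₀ ≡ v₀ → ∃ λ j → SameCopy H G f (local-copy j)
    local-complete f fh₀≡v₀ =
      let (s , f≗) = local f fh₀≡v₀ ; (j , s≋j) = κ-complete s in
      j , ≋-trans (≗⇒≋ f≗) (≋-cong decode s≋j)

    local-meet : ∀ i j x y → proj₁ (local-copy i) x ≡ proj₁ (local-copy j) y →
      i ≡ j ⊎ proj₁ (local-copy i) x ≡ v₀
    local-meet i j x y eq = Sum.map₂ (cong decode) (κ-meet i j x y (decode-injective _ _ eq))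

    local-neighbour : ∀ w → v₀ ~ w → ∃ λ j → InCopy H G (local-copy j) w
    local-neighbour w vw =
      let (j , x , eq) = κ-neighbour (encode w)
            (subst (λ c → T (adj c (encode w))) (encode-decode origin) (proj₁ (encode-~ v₀ w) vw))
      in j , x , trans (cong decode eq) (decode-encode w)

    open Copies H G _≟ᵖ_ ~-irreflexive h₀ h₁ h₁≢h₀ rebase v₀ translate
      local-copy local-h₀ local-complete local-meet local-neighbour public

    translated : I → Emb H G
    translated = copy ∘ translation ∘ ι

    translated-distinct : ∀ i j → SameCopy H G (translated i) (translated j) → i ≡ j
    translated-distinct i j eq = ι-distinct i j (≋-injective decode-injective eq)

    translated-complete : ∀ v j → ∃ λ i → SameCopy H G (copyAt v j) (translated i)
    translated-complete v j =
      let (i , eq) = ι-complete (encode v) j in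
      i , ≋-trans (≗⇒≋ λ x → automorphism-decode (translation (encode v)) _) (≋-cong decode eq)

    open Enumeration I-card translated translated-distinct translated-complete public

Code-card : HasCard Code _≡_ 42
Code-card = HasCard-× (HasCard-Fin 7) (HasCard-× (HasCard-Fin 3) (HasCard-Fin 2))

Stabiliser-card : HasCard Stabiliser _≡_ 24
Stabiliser-card = HasCard-× (HasCard-Fin 4) (HasCard-× (HasCard-Fin 3) (HasCard-Fin 2))

-- Tetrahedra

-- The points 0, 3, 5, 6 form the complement of the line {1,2,4}; opposite edges lie at equal
-- positions.
tetrahedron : Fin 4 → Code
tetrahedron = lookup
  (origin ∷ (# 3 , # 2 , # 1) ∷ (# 5 , # 0 , # 1) ∷ (# 6 , # 1 , # 1) ∷ [])

opaque
  tetrahedron-injective : ∀ x y → tetrahedron x ≡ tetrahedron y → x ≡ y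
  tetrahedron-injective = toWitness {a? = all? λ x → all? λ y → (_ ≟ᶜ _) →-dec (_ F.≟ _)} _

  tetrahedron-induced : ∀ x y → (x ≢ y → T (adj (tetrahedron x) (tetrahedron y))) ×
    (T (adj (tetrahedron x) (tetrahedron y)) → x ≢ y)
  tetrahedron-induced = toWitness {a? = all? λ x → all? λ y →
    (¬? (x F.≟ y) →-dec T? _) ×-dec (T? _ →-dec ¬? (x F.≟ y))} _

  -- There are 4 · 3! = 24 such ordered tetrahedra, as many as stabilising elements. Each adjacency
  -- stands as early as possible, to cut the search before the next quantifier.
  tetrahedra-at-origin : ∀ x₁ → T (adj origin x₁) → ∀ x₂ → T (adj origin x₂) → T (adj x₁ x₂) →
    ∀ x₃ → T (adj origin x₃) → T (adj x₁ x₃) → T (adj x₂ x₃) →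
    ∃ λ s → ∀ x → ⟦ stabiliser s ⟧ (tetrahedron x) ≡ lookup (origin ∷ x₁ ∷ x₂ ∷ x₃ ∷ []) x
  tetrahedra-at-origin = toWitness {a? =
    allᶜ? λ x₁ → T? _ →-dec allᶜ? λ x₂ → T? _ →-dec T? _ →-dec
    allᶜ? λ x₃ → T? _ →-dec T? _ →-dec T? _ →-dec
    anyˢ? λ s → all? λ x → _ ≟ᶜ _} _

tetrahedron-local : ∀ (f : Emb K4 G) → proj₁ f (# 0) ≡ v₀ →
  ∃ λ s → ∀ x → proj₁ f x ≡ decode (⟦ stabiliser s ⟧ (tetrahedron x))
tetrahedron-local (f , _ , f-hom) f0≡v₀ =
  let (s , eq) = tetrahedra-at-origin (vertex (# 1)) (from-origin (# 1) λ ())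
        (vertex (# 2)) (from-origin (# 2) λ ()) (edge (# 1) (# 2) λ ())
        (vertex (# 3)) (from-origin (# 3) λ ()) (edge (# 1) (# 3) λ ()) (edge (# 2) (# 3) λ ())
  in s , λ x → trans (sym (decode-encode (f x))) (cong decode (trans (vertices x) (sym (eq x))))
  where
  vertex : Fin 4 → Code
  vertex = encode ∘ f

  vertex0≡origin : vertex (# 0) ≡ origin
  vertex0≡origin = trans (cong encode f0≡v₀) (encode-decode origin)

  edge : ∀ x y → x ≢ y → T (adj (vertex x) (vertex y))
  edge x y x≢y = proj₁ (encode-~ _ _) (proj₁ (f-hom x y) x≢y)

  from-origin : ∀ x → # 0 ≢ x → T (adj origin (vertex x))
  from-origin x 0≢x = subst (λ c → T (adj c (vertex x))) vertex0≡origin (edge (# 0) x 0≢x)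

  vertices : ∀ x → vertex x ≡ lookup (origin ∷ vertex (# 1) ∷ vertex (# 2) ∷ vertex (# 3) ∷ []) x
  vertices zero = vertex0≡origin
  vertices (suc zero) = refl
  vertices (suc (suc zero)) = refl
  vertices (suc (suc (suc zero))) = refl

module K4-model = Model K4 (# 0) tetrahedron refl
  tetrahedron-injective tetrahedron-induced tetrahedron-local

transpose-comm : ∀ {n} (i j k : Fin n) → transpose i j k ≡ transpose j i k
transpose-comm i j k with k F.≟ i in k≟i | k F.≟ j in k≟j
... | yes refl | yes refl = refl
... | yes _ | no _ rewrite k≟i = refl
... | no _ | yes _ rewrite k≟j = refl
... | no _ | no _ rewrite k≟i | k≟j = refl

transpose-involutive : ∀ {n} (i j k : Fin n) → transpose i j (transpose i j k) ≡ k
transpose-involutive i j k =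
  trans (cong (transpose i j) (transpose-comm i j k)) (transpose-inverse i j)

transpose-injective : ∀ {n} (i j : Fin n) {x y} → transpose i j x ≡ transpose i j y → x ≡ y
transpose-injective i j {x} {y} eq = trans (sym (transpose-involutive i j x))
  (trans (cong (transpose i j) eq) (transpose-involutive i j y))

K4-permutation : (π : Fin 4 → Fin 4) → (∀ x → π (π x) ≡ x) → Aut K4
K4-permutation π ππ = involutionAut π ππ λ x y x≢y πx≡πy →
  x≢y (trans (sym (ππ x)) (trans (cong π πx≡πy) (ππ y)))

-- The translations act regularly on the tetrahedra; these four move the standard
-- one to the tetrahedra through the origin.
tetrahedronBase : Fin 4 → Code
tetrahedronBase = lookup (origin ∷ (# 1 , # 1 , # 1) ∷ (# 2 , # 0 , # 1) ∷ (# 4 , # 2 , # 1) ∷ [])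

opaque
  -- The powers of ξ carry the standard tetrahedron to the four through the origin.
  tetrahedra-complete : ∀ s → ∃ λ j →
    (⟦ stabiliser s ⟧ ∘ tetrahedron) ≋ (⟦ stabiliser (j , # 0 , # 0) ⟧ ∘ tetrahedron)
  tetrahedra-complete = toWitness {a? = allˢ? λ s → any? λ j →
    (all? λ x → any? λ y → _ ≟ᶜ _) ×-dec (all? λ y → any? λ x → _ ≟ᶜ _)} _

  tetrahedra-meet : ∀ (i j : Fin 4) x y →
    ⟦ stabiliser (i , # 0 , # 0) ⟧ (tetrahedron x) ≡
      ⟦ stabiliser (j , # 0 , # 0) ⟧ (tetrahedron y) →
    i ≡ j ⊎ ⟦ stabiliser (i , # 0 , # 0) ⟧ (tetrahedron x) ≡ origin
  tetrahedra-meet = toWitness {a? = all? λ i → all? λ j → all? λ x → all? λ y →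
    (_ ≟ᶜ _) →-dec ((i F.≟ j) ⊎-dec (_ ≟ᶜ _))} _

  tetrahedra-neighbour : ∀ w → T (adj origin w) →
    ∃ λ j → ∃ λ x → ⟦ stabiliser (j , # 0 , # 0) ⟧ (tetrahedron x) ≡ w
  tetrahedra-neighbour = toWitness {a? = allᶜ? λ w → T? _ →-dec any? λ j → any? λ x → _ ≟ᶜ _} _

  tetrahedra-distinct : ∀ c d →
    (⟦ translation c ⟧ ∘ tetrahedron) ≋ (⟦ translation d ⟧ ∘ tetrahedron) → c ≡ d
  tetrahedra-distinct = toWitness {a? = allᶜ? λ c → allᶜ? λ d →
    ((all? λ x → any? λ y → _ ≟ᶜ _) ×-dec (all? λ y → any? λ x → _ ≟ᶜ _)) →-dec (c ≟ᶜ d)} _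

  -- As translations act regularly, the product of those for `c` and `d` is the one for the image of
  -- `d` under the first.
  tetrahedra-translates : ∀ c j →
    (⟦ translation c ⟧ ∘ ⟦ stabiliser (j , # 0 , # 0) ⟧ ∘ tetrahedron) ≋
    (⟦ translation (⟦ translation c ⟧ (tetrahedronBase j)) ⟧ ∘ tetrahedron)
  tetrahedra-translates = toWitness {a? = allᶜ? λ c → all? λ j →
    (all? λ x → any? λ y → _ ≟ᶜ _) ×-dec (all? λ y → any? λ x → _ ≟ᶜ _)} _

K4-rebase : ∀ x → ∃ λ (π : Aut K4) → proj₁ π (# 0) ≡ x
K4-rebase x =
  K4-permutation (transpose zero x) (transpose-involutive zero x) , refl

module K4-copies = K4-model.Counting (# 1) (λ ())
  K4-rebase (λ j → j , # 0 , # 0) tetrahedra-complete tetrahedra-meet tetrahedra-neighbour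
  Code-card id tetrahedra-distinct
  (λ c j → ⟦ translation c ⟧ (tetrahedronBase j) , tetrahedra-translates c j)

-- Octahedra

all²? : ∀ {P : Fin 3 × Fin 2 → Set} → Decidable P → Dec (∀ x → P x)
all²? = all×? all? all?

any²? : ∀ {P : Fin 3 × Fin 2 → Set} → Decidable P → Dec (∃ P)
any²? = any×? any? any?

-- The six pencils with the line {0,1,3} at position 0. This line has types 0, 1, 2 at its points,
-- and the table 0, 2, 1 holds their negatives modulo 3.
octahedron : Fin 3 × Fin 2 → Code
octahedron (n , e) =
  lookup (# 0 ∷ # 1 ∷ # 3 ∷ []) n , position (# 0) e (lookup (# 0 ∷ # 2 ∷ # 1 ∷ []) n) , e

octahedronVertices : (y₀ x₁ y₁ x₂ y₂ : Code) → Fin 3 × Fin 2 → Code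
octahedronVertices y₀ x₁ y₁ x₂ y₂ (n , e) =
  lookup (lookup ((origin ∷ y₀ ∷ []) ∷ (x₁ ∷ y₁ ∷ []) ∷ (x₂ ∷ y₂ ∷ []) ∷ []) n) e

opaque
  octahedron-injective : ∀ x y → octahedron x ≡ octahedron y → x ≡ y
  octahedron-injective = toWitness {a? = all²? λ x → all²? λ y →
    (_ ≟ᶜ _) →-dec ×.≡-dec F._≟_ F._≟_ x y} _

  octahedron-induced : ∀ x y → (proj₁ x ≢ proj₁ y → T (adj (octahedron x) (octahedron y))) ×
    (T (adj (octahedron x) (octahedron y)) → proj₁ x ≢ proj₁ y)
  octahedron-induced = toWitness {a? = all²? λ x → all²? λ y →
    (¬? (proj₁ x F.≟ proj₁ y) →-dec T? _) ×-dec (T? _ →-dec ¬? (proj₁ x F.≟ proj₁ y))} _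

  -- Three octahedra with 8 labellings each give 24 cases. The vertex `y₀` comes last, when its four
  -- neighbours are already chosen.
  octahedra-at-origin : ∀ x₁ → T (adj origin x₁) → ∀ x₂ → T (adj origin x₂) → T (adj x₁ x₂) →
    ∀ y₁ → T (adj origin y₁) → T (adj x₂ y₁) → ¬ T (adj x₁ y₁) → x₁ ≢ y₁ →
    ∀ y₂ → T (adj origin y₂) → T (adj x₁ y₂) → T (adj y₁ y₂) → ¬ T (adj x₂ y₂) → x₂ ≢ y₂ →
    ∀ y₀ → T (adj x₁ y₀) → T (adj x₂ y₀) → T (adj y₁ y₀) → T (adj y₂ y₀) →
    ¬ T (adj origin y₀) → origin ≢ y₀ →
    ∃ λ s → ∀ x → ⟦ stabiliser s ⟧ (octahedron x) ≡ octahedronVertices y₀ x₁ y₁ x₂ y₂ x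
  octahedra-at-origin = toWitness {a? =
    allᶜ? λ x₁ → T? _ →-dec allᶜ? λ x₂ → T? _ →-dec T? _ →-dec
    allᶜ? λ y₁ → T? _ →-dec T? _ →-dec ¬? (T? _) →-dec ¬? (_ ≟ᶜ _) →-dec
    allᶜ? λ y₂ → T? _ →-dec T? _ →-dec T? _ →-dec ¬? (T? _) →-dec ¬? (_ ≟ᶜ _) →-dec
    allᶜ? λ y₀ → T? _ →-dec T? _ →-dec T? _ →-dec T? _ →-dec ¬? (T? _) →-dec ¬? (_ ≟ᶜ _) →-dec
    anyˢ? λ s → all²? λ x → _ ≟ᶜ _} _

octahedron-local : ∀ (f : Emb K222 G) → proj₁ f (# 0 , # 0) ≡ v₀ →
  ∃ λ s → ∀ x → proj₁ f x ≡ decode (⟦ stabiliser s ⟧ (octahedron x))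
octahedron-local (f , f-inj , f-hom) f0≡v₀ =
  let (s , eq) = octahedra-at-origin
        (vertex x₁) (from-origin x₁ λ ())
        (vertex x₂) (from-origin x₂ λ ()) (edge x₁ x₂ λ ())
        (vertex y₁) (from-origin y₁ λ ()) (edge x₂ y₁ λ ())
          (non-edge x₁ y₁ refl) (distinct x₁ y₁ λ ())
        (vertex y₂) (from-origin y₂ λ ()) (edge x₁ y₂ λ ()) (edge y₁ y₂ λ ())
          (non-edge x₂ y₂ refl) (distinct x₂ y₂ λ ())
        (vertex y₀) (edge x₁ y₀ λ ()) (edge x₂ y₀ λ ()) (edge y₁ y₀ λ ()) (edge y₂ y₀ λ ())
          (subst (λ c → ¬ T (adj c (vertex y₀))) vertex0≡origin (non-edge x₀ y₀ refl))
          (subst (_≢ vertex y₀) vertex0≡origin (distinct x₀ y₀ λ ()))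
  in s , λ x → trans (sym (decode-encode (f x))) (cong decode (trans (vertices x) (sym (eq x))))
  where
  x₀ y₀ x₁ y₁ x₂ y₂ : Fin 3 × Fin 2
  x₀ = # 0 , # 0
  y₀ = # 0 , # 1
  x₁ = # 1 , # 0
  y₁ = # 1 , # 1
  x₂ = # 2 , # 0
  y₂ = # 2 , # 1

  vertex : Fin 3 × Fin 2 → Code
  vertex = encode ∘ f

  vertex0≡origin : vertex x₀ ≡ origin
  vertex0≡origin = trans (cong encode f0≡v₀) (encode-decode origin)

  edge : ∀ x y → proj₁ x ≢ proj₁ y → T (adj (vertex x) (vertex y))
  edge x y x≢y = proj₁ (encode-~ _ _) (proj₁ (f-hom x y) x≢y)

  non-edge : ∀ x y → proj₁ x ≡ proj₁ y → ¬ T (adj (vertex x) (vertex y))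
  non-edge x y x≡y xy = proj₂ (f-hom x y) (proj₂ (encode-~ _ _) xy) x≡y

  distinct : ∀ x y → x ≢ y → vertex x ≢ vertex y
  distinct x y x≢y eq = x≢y (f-inj x y (encode-injective eq))

  from-origin : ∀ x → # 0 ≢ proj₁ x → T (adj origin (vertex x))
  from-origin x 0≢x = subst (λ c → T (adj c (vertex x))) vertex0≡origin (edge x₀ x 0≢x)

  vertices : ∀ x → vertex x ≡
    octahedronVertices (vertex y₀) (vertex x₁) (vertex y₁) (vertex x₂) (vertex y₂) x
  vertices (zero , zero) = vertex0≡origin
  vertices (zero , suc zero) = refl
  vertices (suc zero , zero) = refl
  vertices (suc zero , suc zero) = refl
  vertices (suc (suc zero) , zero) = refl
  vertices (suc (suc zero) , suc zero) = refl

module K222-model = Model K222 (# 0 , # 0) octahedron refl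
  octahedron-injective octahedron-induced octahedron-local

⊕-involutive : ∀ (e f : Fin 2) → e ⊕ (e ⊕ f) ≡ f
⊕-involutive = toWitness {a? = all? λ e → all? λ f → _ F.≟ _} _

K222-rebase : ∀ x → ∃ λ (π : Aut K222) → proj₁ π (# 0 , # 0) ≡ x
K222-rebase (n , e) =
  involutionAut (Product.map (transpose zero n) (e ⊕_))
    (λ (k , f) → cong₂ _,_ (transpose-involutive zero n k) (⊕-involutive e f))
    (λ x y x≢y eq → x≢y (transpose-injective zero n eq)) ,
  cong (n ,_) (⊕-zero e)
  where
  ⊕-zero : ∀ (e : Fin 2) → e ⊕ # 0 ≡ e
  ⊕-zero = toWitness {a? = all? λ e → _ F.≟ _} _

-- The octahedra are permuted transitively by the translations ρⁱ σᵏ φᵉ, with φ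
-- stabilising the standard one.
octahedronBase : Fin 3 → Code
octahedronBase = lookup (origin ∷ (# 6 , # 1 , # 0) ∷ (# 4 , # 2 , # 0) ∷ [])

octahedronIndex : Code → Fin 7 × Fin 3
octahedronIndex (i , k , _) = i , k

octahedronCode : Fin 7 × Fin 3 → Code
octahedronCode (i , k) = i , k , # 0

opaque
  -- The powers of μ carry the standard octahedron to the three through the origin, one for each
  -- line through the point 0.
  octahedra-complete : ∀ s → ∃ λ j →
    (⟦ stabiliser s ⟧ ∘ octahedron) ≋ (⟦ stabiliser (# 0 , j , # 0) ⟧ ∘ octahedron)
  octahedra-complete = toWitness {a? = allˢ? λ s → any? λ j →
    (all²? λ x → any²? λ y → _ ≟ᶜ _) ×-dec (all²? λ y → any²? λ x → _ ≟ᶜ _)} _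

  octahedra-meet : ∀ (i j : Fin 3) x y →
    ⟦ stabiliser (# 0 , i , # 0) ⟧ (octahedron x) ≡ ⟦ stabiliser (# 0 , j , # 0) ⟧ (octahedron y) →
    i ≡ j ⊎ ⟦ stabiliser (# 0 , i , # 0) ⟧ (octahedron x) ≡ origin
  octahedra-meet = toWitness {a? = all? λ i → all? λ j → all²? λ x → all²? λ y →
    (_ ≟ᶜ _) →-dec ((i F.≟ j) ⊎-dec (_ ≟ᶜ _))} _

  octahedra-neighbour : ∀ w → T (adj origin w) →
    ∃ λ j → ∃ λ x → ⟦ stabiliser (# 0 , j , # 0) ⟧ (octahedron x) ≡ w
  octahedra-neighbour = toWitness {a? = allᶜ? λ w → T? _ →-dec any? λ j → any²? λ x → _ ≟ᶜ _} _

  octahedra-distinct : ∀ i j → (⟦ translation (octahedronCode i) ⟧ ∘ octahedron) ≋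
    (⟦ translation (octahedronCode j) ⟧ ∘ octahedron) → i ≡ j
  octahedra-distinct = toWitness {a? = all×? all? all? λ i → all×? all? all? λ j →
    ((all²? λ x → any²? λ y → _ ≟ᶜ _) ×-dec (all²? λ y → any²? λ x → _ ≟ᶜ _)) →-dec
    ×.≡-dec F._≟_ F._≟_ i j} _

  octahedra-translates : ∀ c j →
    (⟦ translation c ⟧ ∘ ⟦ stabiliser (# 0 , j , # 0) ⟧ ∘ octahedron) ≋
    (⟦ translation (octahedronCode (octahedronIndex (⟦ translation c ⟧ (octahedronBase j)))) ⟧
      ∘ octahedron)
  octahedra-translates = toWitness {a? = allᶜ? λ c → all? λ j →
    (all²? λ x → any²? λ y → _ ≟ᶜ _) ×-dec (all²? λ y → any²? λ x → _ ≟ᶜ _)} _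

module K222-copies = K222-model.Counting (# 0 , # 1) (λ ()) K222-rebase
  (λ j → # 0 , j , # 0) octahedra-complete octahedra-meet octahedra-neighbour
  (HasCard-× (HasCard-Fin 7) (HasCard-Fin 3)) octahedronCode octahedra-distinct
  (λ c j → octahedronIndex (⟦ translation c ⟧ (octahedronBase j)) , octahedra-translates c j)

-- Rigidity: an automorphism preserves adjacency and the relation of being opposite in an
-- octahedron, and these two relations to the vertices of a tetrahedron determine first
-- the twelve vertices opposite to those of the tetrahedron, and then all others.

twin : Fin 4 → Fin 3 → Code
twin x k = let (i , l , e) = tetrahedron x in i , l ⊕ k , e ⊕ # 1

Agree : Code → Code → Code → Set
Agree z x y = (adj z x ≡ adj z y) × (opposite z x ≡ opposite z y)

agree? : ∀ z x y → Dec (Agree z x y)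
agree? z x y = (_ B.≟ _) ×-dec (_ B.≟ _)

opaque
  opposite⇒octahedron : ∀ u w → T (opposite u w) → ∃ λ s →
    ⟦ translation u ⟧ (⟦ stabiliser s ⟧ (octahedron (# 0 , # 0))) ≡ u ×
    ⟦ translation u ⟧ (⟦ stabiliser s ⟧ (octahedron (# 0 , # 1))) ≡ w
  opposite⇒octahedron = toWitness {a? = allᶜ? λ u → allᶜ? λ w → T? _ →-dec anyˢ? λ s →
    (_ ≟ᶜ _) ×-dec (_ ≟ᶜ _)} _

  twins-determined : ∀ x k y → (∀ z → Agree (tetrahedron z) (twin x k) y) → y ≡ twin x k
  twins-determined = toWitness {a? = all? λ x → all? λ k → allᶜ? λ y →
    (all? λ z → agree? (tetrahedron z) (twin x k) y) →-dec (_ ≟ᶜ _)} _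

  all-determined : ∀ c y → (∀ x k → Agree (twin x k) c y) → y ≡ c
  all-determined = toWitness {a? = allᶜ? λ c → allᶜ? λ y →
    (all? λ x → all? λ k → agree? (twin x k) c y) →-dec (_ ≟ᶜ _)} _

-- Defined through embeddings, hence carried along by every automorphism of `G`; the coordinates in
-- `opposite` show this only for words in the generators.
Opposite : Pencil → Pencil → Set
Opposite v w = ∃ λ (f : Emb K222 G) → proj₁ f (# 0 , # 0) ≡ v × proj₁ f (# 0 , # 1) ≡ w

opposite⇒Opposite : ∀ u w → T (opposite u w) → Opposite (decode u) (decode w)
opposite⇒Opposite u w uw =
  let (s , eq₀ , eq₁) = opposite⇒octahedron u w uw in
  compose K222 G (element (u , s)) (K222-model.copy []) ,
  trans (element-decode u s _) (cong decode eq₀) , trans (element-decode u s _) (cong decode eq₁)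

-- Every octahedron is the image of the standard one under a word, words preserve `opposite`, and
-- the standard octahedron is checked directly.
Opposite⇒opposite : ∀ {u w} → Opposite (decode u) (decode w) → T (opposite u w)
Opposite⇒opposite {u} {w} (f , f0≡u , f1≡w) =
  subst T (trans (sym preserved) (cong₂ opposite (code≡ x₀ f0≡u) (code≡ x₁ f1≡w))) tt
  where
  x₀ x₁ : Fin 3 × Fin 2
  x₀ = # 0 , # 0
  x₁ = # 0 , # 1

  c : Code
  c = proj₁ (proj₁ (K222-model.reach f))

  s : Stabiliser
  s = proj₂ (proj₁ (K222-model.reach f))

  image : Fin 3 × Fin 2 → Code
  image x = ⟦ translation c ⟧ (⟦ stabiliser s ⟧ (octahedron x))

  preserved : opposite (image x₀) (image x₁) ≡ true
  preserved = trans
    (⟦⟧-opposite (translation c)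
      (⟦ stabiliser s ⟧ (octahedron x₀)) (⟦ stabiliser s ⟧ (octahedron x₁)))
    (⟦⟧-opposite (stabiliser s) (octahedron x₀) (octahedron x₁))

  code≡ : ∀ x {c′} → proj₁ f x ≡ decode c′ → image x ≡ c′
  code≡ x fx≡c′ = decode-injective _ _ (trans (sym (element-decode c s (octahedron x)))
    (trans (sym (proj₂ (K222-model.reach f) x)) fx≡c′))

T-ext : ∀ a b → (T a → T b) → (T b → T a) → a ≡ b
T-ext false false _ _ = refl
T-ext false true _ g = ⊥-elim (g tt)
T-ext true false f _ = ⊥-elim (f tt)
T-ext true true _ _ = refl

module _ (α : Aut G) where

  onCodes : Code → Code
  onCodes = encode ∘ proj₁ α ∘ decode

  decode-onCodes : ∀ c → decode (onCodes c) ≡ proj₁ α (decode c)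
  decode-onCodes c = decode-encode _

  onCodes-adj : ∀ u w → adj (onCodes u) (onCodes w) ≡ adj u w
  onCodes-adj u w = T-ext _ _
    (λ t → proj₂ (decode-~ u w) (proj₂ α-hom (proj₂ (encode-~ _ _) t)))
    (λ t → proj₁ (encode-~ _ _) (proj₁ α-hom (proj₁ (decode-~ u w) t)))
    where α-hom = proj₂ (proj₂ (proj₂ α)) (decode u) (decode w)

  onCodes-opposite : ∀ u w → opposite (onCodes u) (onCodes w) ≡ opposite u w
  onCodes-opposite u w = T-ext _ _
    (λ t → let (f , f0 , f1) = opposite⇒Opposite _ _ t in Opposite⇒opposite
      (compose K222 G (inverse α) f ,
       inverse-unique α (trans (sym (decode-onCodes u)) (sym f0)) ,
       inverse-unique α (trans (sym (decode-onCodes w)) (sym f1))))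
    (λ t → let (f , f0 , f1) = opposite⇒Opposite u w t in Opposite⇒opposite
      (compose K222 G α f ,
       trans (cong (proj₁ α) f0) (sym (decode-onCodes u)) ,
       trans (cong (proj₁ α) f1) (sym (decode-onCodes w))))

  fixed-agree : ∀ {z} → onCodes z ≡ z → ∀ c → Agree z c (onCodes c)
  fixed-agree {z} fixed c =
    trans (sym (onCodes-adj z c)) (cong (λ t → adj t (onCodes c)) fixed) ,
    trans (sym (onCodes-opposite z c)) (cong (λ t → opposite t (onCodes c)) fixed)

  rigid : (∀ x → proj₁ α (decode (tetrahedron x)) ≡ decode (tetrahedron x)) →
    ∀ v → proj₁ α v ≡ v
  rigid fixes v =
    trans (cong (proj₁ α) (sym (decode-encode v)))
      (trans (sym (decode-onCodes (encode v)))
        (trans (cong decode (all-determined _ _ λ x k → fixed-agree (twins-fixed x k) (encode v)))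
               (decode-encode v)))
    where
    tetrahedron-fixed : ∀ x → onCodes (tetrahedron x) ≡ tetrahedron x
    tetrahedron-fixed x = trans (cong encode (fixes x)) (encode-decode _)

    twins-fixed : ∀ x k → onCodes (twin x k) ≡ twin x k
    twins-fixed x k = twins-determined x k _ λ z → fixed-agree (tetrahedron-fixed z) (twin x k)

-- If γ carries the standard tetrahedron to `f`, then γ⁻¹β⁻¹αγ fixes the standard one pointwise, and
-- `rigid` applies.
automorphism-unique : ∀ (α β : Aut G) (f : Emb K4 G) →
  (∀ x → proj₁ α (proj₁ f x) ≡ proj₁ β (proj₁ f x)) → _≈Aut_ G α β
automorphism-unique α β f αf≗βf v =
  let (g , f≗) = K4-model.reach f
      γ = element g
      fixes = rigid (inverse γ ∘ᵃ (inverse β ∘ᵃ (α ∘ᵃ γ))) λ x →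
        inverse-unique γ (sym (inverse-unique β (sym (trans
          (cong (proj₁ α) (sym (f≗ x))) (trans (αf≗βf x) (cong (proj₁ β) (f≗ x)))))))
      u = proj₁ (inverse γ) v
      αγu≡βγu = trans (sym (inverseʳ β _)) (cong (proj₁ β) (trans (sym (inverseʳ γ _))
        (cong (proj₁ γ) (fixes u))))
  in trans (cong (proj₁ α) (sym (inverseʳ γ v)))
       (trans αγu≡βγu (cong (proj₁ β) (inverseʳ γ v)))

-- The automorphism group

opaque
  stabiliser-injective : ∀ s t →
    (∀ x → ⟦ stabiliser s ⟧ (tetrahedron x) ≡ ⟦ stabiliser t ⟧ (tetrahedron x)) → s ≡ t
  stabiliser-injective = toWitness {a? = allˢ? λ s → allˢ? λ t →
    (all? λ x → _ ≟ᶜ _) →-dec (s ≟ˢ t)} _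

element-v₀ : ∀ c s → proj₁ (element (c , s)) v₀ ≡ decode c
element-v₀ c s = trans (element-decode c s origin)
  (cong decode (trans (cong ⟦ translation c ⟧ (stabiliser-origin s)) (translation-origin c)))

-- The image of `v₀` recovers the translation; the action on the standard tetrahedron then recovers
-- the stabilising factor.
element-injective : ∀ g h → _≈Aut_ G (element g) (element h) → g ≡ h
element-injective (c , s) (d , t) eq
  with refl ← decode-injective c d (trans (sym (element-v₀ c s)) (trans (eq v₀) (element-v₀ d t))) =
  cong (c ,_) (stabiliser-injective s t λ x → ⟦⟧-injective (translation c)
    (decode-injective _ _
      (trans (sym (element-decode c s _)) (trans (eq _) (element-decode c t _)))))

element-surjective : ∀ α → ∃ λ g → _≈Aut_ G α (element g)
element-surjective α =
  let (g , α≗) = K4-model.reach (compose K4 G α (K4-model.copy [])) in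
  g , automorphism-unique α (element g) (K4-model.copy []) α≗

Aut-card : HasCard (Aut G) (_≈Aut_ G) 1008
Aut-card = HasCard-image (_≈Aut_ G) (HasCard-× Code-card Stabiliser-card)
  element element-injective element-surjective

vertexTransitive : VertexTransitive G
vertexTransitive u w =
  let (α , αv₀≡u) = translate u ; (β , βv₀≡w) = translate w in
  β ∘ᵃ inverse α , trans (cong (proj₁ β) (inverse-unique α αv₀≡u)) βv₀≡w

module _ {v : Pencil} (α : Aut G) (αv₀≡v : proj₁ α v₀ ≡ v) where

  conjugate : Stabiliser → VertexStabilizer G v
  conjugate s = α ∘ᵃ (element (origin , s) ∘ᵃ inverse α) ,
    trans (cong (proj₁ α ∘ proj₁ (element (origin , s))) (inverse-unique α αv₀≡v))
          (trans (cong (proj₁ α) (element-v₀ origin s)) αv₀≡v)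

  conjugate-injective : ∀ s t → _≈Aut_ G (proj₁ (conjugate s)) (proj₁ (conjugate t)) → s ≡ t
  conjugate-injective s t eq = cong proj₂ (element-injective (origin , s) (origin , t) λ u →
    proj₁ (proj₂ α) _ _ (subst
      (λ w → proj₁ α (proj₁ (element (origin , s)) w) ≡ proj₁ α (proj₁ (element (origin , t)) w))
      (inverseˡ α u) (eq (proj₁ α u))))

  conjugate-surjective : (β : VertexStabilizer G v) →
    ∃ λ s → _≈Aut_ G (proj₁ β) (proj₁ (conjugate s))
  conjugate-surjective (β , βv≡v) =
    let γ = inverse α ∘ᵃ (β ∘ᵃ α)
        γv₀≡v₀ = inverse-unique α (trans αv₀≡v (trans (sym βv≡v) (cong (proj₁ β) (sym αv₀≡v))))
        ((c , s) , γ≗) = element-surjective γ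
        -- The conjugate γ fixes `v₀`, whereas an element sends `v₀` to the vertex coded by its
        -- translation part.
        c≡origin = decode-injective c origin
          (trans (sym (element-v₀ c s)) (trans (sym (γ≗ v₀)) γv₀≡v₀))
    in s , λ w → trans (sym (trans (inverseʳ α _) (cong (proj₁ β) (inverseʳ α w))))
         (cong (proj₁ α) (trans (γ≗ (proj₁ (inverse α) w))
           (cong (λ d → proj₁ (element (d , s)) (proj₁ (inverse α) w)) c≡origin)))

  conjugates-card : HasCard (VertexStabilizer G v) (λ s t → _≈Aut_ G (proj₁ s) (proj₁ t)) 24
  conjugates-card = HasCard-image (λ s t → _≈Aut_ G (proj₁ s) (proj₁ t)) Stabiliser-card
    conjugate conjugate-injective conjugate-surjective

vertexStabiliser-card : ∀ v →
  HasCard (VertexStabilizer G v) (λ s t → _≈Aut_ G (proj₁ s) (proj₁ t)) 24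
vertexStabiliser-card v = conjugates-card (proj₁ (translate v)) (proj₂ (translate v))

-- Edges

-- Every edge is oriented so that the head minus the tail is a square in ℤ/7;
-- head u (x , f) runs over the out-neighbours of u along the line of type x.
head : Code → Fin 3 × Fin 2 → Code
head (i , k , e) (x , f) =
  -- The middle entry l gives the line the same position n at both ends: with t its type at `j`, n =
  -- l ± t yields l = n ∓ t, hence the reversed sign `# 1 ⊖ f`.
  j , position (position k e x) (# 1 ⊖ f) (type (i ⊖ j)) , f
  where j = i ⊕ representative x

opaque
  head-adj : ∀ u x → T (adj u (head u x))
  head-adj = toWitness {a? = allᶜ? λ u → all²? λ x → T? _} _

  head-injective : ∀ u x y → head u x ≡ head u y → x ≡ y
  head-injective = toWitness {a? = allᶜ? λ u → all²? λ x → all²? λ y →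
    (_ ≟ᶜ _) →-dec ×.≡-dec F._≟_ F._≟_ x y} _

  -- Since -1 is not a square modulo 7, no two squares 1, 2, 4 add up to 0.
  head-asymmetric : ∀ u x y → head (head u x) y ≢ u
  head-asymmetric = toWitness {a? = allᶜ? λ u → all²? λ x → all²? λ y → ¬? (_ ≟ᶜ _)} _

  head-complete : ∀ u w → T (adj u w) → (∃ λ x → head u x ≡ w) ⊎ (∃ λ x → head w x ≡ u)
  head-complete = toWitness {a? = allᶜ? λ u → allᶜ? λ w → T? _ →-dec
    ((any²? λ x → _ ≟ᶜ _) ⊎-dec (any²? λ x → _ ≟ᶜ _))} _

  tetrahedra-on-arcs : ∀ w → T (adj origin w) →
    ∃ λ s → ⟦ stabiliser s ⟧ (tetrahedron (# 1)) ≡ w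
  tetrahedra-on-arcs = toWitness {a? = allᶜ? λ w → T? _ →-dec anyˢ? λ s → _ ≟ᶜ _} _

Edge-card : HasCard (Edge G) (SameEdge G) 252
Edge-card = HasCard-image (SameEdge G)
  (HasCard-× Code-card (HasCard-× (HasCard-Fin 3) (HasCard-Fin 2)))
  edge edge-injective edge-surjective
  where
  edge : Code × (Fin 3 × Fin 2) → Edge G
  edge (u , x) = (decode u , decode (head u x)) , proj₁ (decode-~ _ _) (head-adj u x)

  edge-injective : ∀ e e′ → SameEdge G (edge e) (edge e′) → e ≡ e′
  edge-injective (u , x) (w , y) (inj₁ (u≡w , hu≡hw)) with refl ← decode-injective u w u≡w =
    cong (u ,_) (head-injective u x y (decode-injective _ _ hu≡hw))
  edge-injective (u , x) (w , y) (inj₂ (u≡hw , hu≡w)) =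
    contradiction (trans (cong (λ c → head c x) (sym (decode-injective _ _ u≡hw)))
                         (decode-injective _ _ hu≡w))
                  (head-asymmetric w y x)

  edge-surjective : ∀ e → ∃ λ i → SameEdge G e (edge i)
  edge-surjective ((v , w) , vw) with head-complete (encode v) (encode w) (proj₁ (encode-~ v w) vw)
  ... | inj₁ (x , eq) = (encode v , x) , inj₁
    (sym (decode-encode v) , trans (sym (decode-encode w)) (cong decode (sym eq)))
  ... | inj₂ (x , eq) = (encode w , x) , inj₂
    (trans (sym (decode-encode v)) (cong decode (sym eq)) , sym (decode-encode w))

-- Edge transitivity and edge stabilisers

neighbour-code : ∀ (α : Aut G) {u w} → proj₁ α v₀ ≡ u → u ~ w →
  T (adj origin (encode (proj₁ (inverse α) w)))
neighbour-code α {u} {w} αv₀≡u uw =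
  subst (λ c → T (adj c (encode (proj₁ (inverse α) w))))
    (trans (cong encode (inverse-unique α αv₀≡u)) (encode-decode origin))
    (proj₁ (encode-~ _ _) (proj₁ (proj₂ (proj₂ (proj₂ (inverse α))) u w) uw))

opaque
  -- Turns questions about ordered edges into questions about ordered tetrahedra, to which
  -- ultrahomogeneity and rigidity apply.
  tetrahedronOnArc : ∀ u w → u ~ w →
    ∃ λ (f : Emb K4 G) → proj₁ f (# 0) ≡ u × proj₁ f (# 1) ≡ w
  tetrahedronOnArc u w uw =
    let (α , αv₀≡u) = translate u
        (s , eq) = tetrahedra-on-arcs _ (neighbour-code α αv₀≡u uw)
    in compose K4 G α (K4-model.copy (stabiliser s)) ,
       trans (cong (proj₁ α ∘ decode) (stabiliser-origin s)) αv₀≡u ,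
       trans (cong (proj₁ α) (trans (cong decode eq) (decode-encode _))) (inverseʳ α w)

edgeTransitive : EdgeTransitive G
edgeTransitive ((u , w) , uw) ((u′ , w′) , uw′) =
  let (f , f0≡u , f1≡w) = tetrahedronOnArc u w uw
      (g , g0≡u′ , g1≡w′) = tetrahedronOnArc u′ w′ uw′
      (α , αf≗g) = K4-model.ultrahomogeneous f g
  in α , inj₁ (trans (cong (proj₁ α) (sym f0≡u)) (trans (αf≗g (# 0)) g0≡u′) ,
               trans (cong (proj₁ α) (sym f1≡w)) (trans (αf≗g (# 1)) g1≡w′))

-- The permutations of a tetrahedron that preserve the edge {0,1}: `p` decides whether its ends are
-- exchanged, `q` whether the other two vertices are.
swap : Fin 2 × Fin 2 → Fin 4 → Fin 4
swap (p , q) = when p (transpose (# 0) (# 1)) ∘ when q (transpose (# 2) (# 3))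
  where
  when : Fin 2 → (Fin 4 → Fin 4) → Fin 4 → Fin 4
  when zero π = id
  when (suc zero) π = π

opaque
  swap-involutive : ∀ i x → swap i (swap i x) ≡ x
  swap-involutive = toWitness {a? = all×? all? all? λ i → all? λ x → _ F.≟ _} _

  swap-injective : ∀ i j → (∀ x → swap i x ≡ swap j x) → i ≡ j
  swap-injective = toWitness {a? = all×? all? all? λ i → all×? all? all? λ j →
    (all? λ x → _ F.≟ _) →-dec ×.≡-dec F._≟_ F._≟_ i j} _

  swap-first : ∀ q x → swap (# 0 , q) (swap (# 1 , # 0) x) ≡ swap (# 1 , q) x
  swap-first = toWitness {a? = all? λ q → all? λ x → _ F.≟ _} _

  -- An element fixing both ends of an edge preserves the only tetrahedron on it, so it can at most
  -- exchange the other two vertices.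
  arc-fixing : ∀ s → ⟦ stabiliser s ⟧ (tetrahedron (# 1)) ≡ tetrahedron (# 1) →
    ∃ λ q → ∀ x → ⟦ stabiliser s ⟧ (tetrahedron x) ≡ tetrahedron (swap (# 0 , q) x)
  arc-fixing = toWitness {a? = allˢ? λ s → (_ ≟ᶜ _) →-dec any? λ q → all? λ x → _ ≟ᶜ _} _

tetrahedra-on-arc : ∀ (f g : Emb K4 G) →
  proj₁ g (# 0) ≡ proj₁ f (# 0) → proj₁ g (# 1) ≡ proj₁ f (# 1) →
  ∃ λ q → ∀ x → proj₁ g x ≡ proj₁ f (swap (# 0 , q) x)
tetrahedra-on-arc f g g0≡f0 g1≡f1 =
  let (i , f≗) = K4-model.reach f
      α = element i
      (s , h≗) = tetrahedron-local (compose K4 G (inverse α) g)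
        (inverse-unique α (trans (sym (f≗ (# 0))) (sym g0≡f0)))
      (q , eq) = arc-fixing s (decode-injective _ _ (trans (sym (h≗ (# 1)))
        (inverse-unique α (trans (sym (f≗ (# 1))) (sym g1≡f1)))))
  in q , λ x → trans (sym (inverseʳ α _)) (trans
       (cong (proj₁ α) (trans (h≗ x) (cong decode (eq x)))) (sym (f≗ _)))

opaque
  swap-extension : ∀ (f : Emb K4 G) i →
    ∃ λ (α : Aut G) → ∀ x → proj₁ α (proj₁ f x) ≡ proj₁ f (swap i x)
  swap-extension f i = K4-model.ultrahomogeneous f
    (reparametrise K4 G f (K4-permutation (swap i) (swap-involutive i)))

module _ {u w : Pencil} (uw : u ~ w)
  (f : Emb K4 G) (f0≡u : proj₁ f (# 0) ≡ u) (f1≡w : proj₁ f (# 1) ≡ w) where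

  private
    e : Edge G
    e = (u , w) , uw

  swap-edge : ∀ i (α : Aut G) → (∀ x → proj₁ α (proj₁ f x) ≡ proj₁ f (swap i x)) →
    SameEdge G (mapEdge G α e) e
  swap-edge i α eq = endpoints i (image f0≡u (eq (# 0))) (image f1≡w (eq (# 1)))
    where
    image : ∀ {x y z} → x ≡ y → proj₁ α x ≡ z → proj₁ α y ≡ z
    image refl eq = eq

    endpoints : ∀ i → proj₁ α u ≡ proj₁ f (swap i (# 0)) → proj₁ α w ≡ proj₁ f (swap i (# 1)) →
      SameEdge G (mapEdge G α e) e
    endpoints (zero , zero) αu αw = inj₁ (trans αu f0≡u , trans αw f1≡w)
    endpoints (zero , suc zero) αu αw = inj₁ (trans αu f0≡u , trans αw f1≡w)
    endpoints (suc zero , zero) αu αw = inj₂ (trans αu f1≡w , trans αw f0≡u)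
    endpoints (suc zero , suc zero) αu αw = inj₂ (trans αu f1≡w , trans αw f0≡u)

  symmetry : Fin 2 × Fin 2 → EdgeStabilizer G e
  symmetry i = proj₁ (swap-extension f i) ,
    swap-edge i (proj₁ (swap-extension f i)) (proj₂ (swap-extension f i))

  symmetry-injective : ∀ i j → _≈Aut_ G (proj₁ (symmetry i)) (proj₁ (symmetry j)) → i ≡ j
  symmetry-injective i j eq = swap-injective i j λ x → proj₁ (proj₂ f) _ _
    (trans (sym (proj₂ (swap-extension f i) x)) (trans (eq _) (proj₂ (swap-extension f j) x)))

  extension-unique : ∀ i (α : Aut G) → (∀ x → proj₁ α (proj₁ f x) ≡ proj₁ f (swap i x)) →
    _≈Aut_ G α (proj₁ (symmetry i))
  extension-unique i α eq = automorphism-unique α (proj₁ (swap-extension f i)) f λ x →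
    trans (eq x) (sym (proj₂ (swap-extension f i) x))

  symmetry-surjective : (α : EdgeStabilizer G e) → ∃ λ i → _≈Aut_ G (proj₁ α) (proj₁ (symmetry i))
  symmetry-surjective (α , inj₁ (αu≡u , αw≡w)) =
    let (q , eq) = tetrahedra-on-arc f (compose K4 G α f)
          (trans (cong (proj₁ α) f0≡u) (trans αu≡u (sym f0≡u)))
          (trans (cong (proj₁ α) f1≡w) (trans αw≡w (sym f1≡w)))
    in (# 0 , q) , extension-unique (# 0 , q) α eq
  symmetry-surjective (α , inj₂ (αu≡w , αw≡u)) =
    -- Precomposing with the transposition (0 1) restores the ends, which reduces this case to the
    -- previous one.
    let π = K4-permutation (swap (# 1 , # 0)) (swap-involutive (# 1 , # 0))
        (q , eq) = tetrahedra-on-arc f (compose K4 G α (reparametrise K4 G f π))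
          (trans (cong (proj₁ α) f1≡w) (trans αw≡u (sym f0≡u)))
          (trans (cong (proj₁ α) f0≡u) (trans αu≡w (sym f1≡w)))
    in (# 1 , q) , extension-unique (# 1 , q) α λ x →
      trans (cong (proj₁ α ∘ proj₁ f) (sym (swap-involutive (# 1 , # 0) x)))
            (trans (eq (swap (# 1 , # 0) x)) (cong (proj₁ f) (swap-first q x)))

  symmetries-card : HasCard (EdgeStabilizer G e) (λ s t → _≈Aut_ G (proj₁ s) (proj₁ t)) 4
  symmetries-card = HasCard-image (λ s t → _≈Aut_ G (proj₁ s) (proj₁ t))
    (HasCard-× (HasCard-Fin 2) (HasCard-Fin 2))
    symmetry symmetry-injective symmetry-surjective

edgeStabiliser-card : ∀ e →
  HasCard (EdgeStabilizer G e) (λ s t → _≈Aut_ G (proj₁ s) (proj₁ t)) 4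
edgeStabiliser-card ((u , w) , uw) =
  let (f , f0≡u , f1≡w) = tetrahedronOnArc u w uw in symmetries-card uw f f0≡u f1≡w

-- Connectedness and regularity

opaque
  -- Length exactly three serves every end vertex, the origin included, without a case distinction
  -- on the distance.
  walks-from-origin : ∀ w → ∃ λ x → T (adj origin x) × ∃ λ y → T (adj x y) × T (adj y w)
  walks-from-origin = toWitness {a? = allᶜ? λ w → anyᶜ? λ x → T? _ ×-dec anyᶜ? λ y →
    T? _ ×-dec T? _} _

G-connected : Connected G
G-connected u w =
  let (α , αv₀≡u) = translate u
      w′ = proj₁ (inverse α) w
      (x , v₀x , y , xy , yw) = walks-from-origin (encode w′)
      walk = _◅_ {j = decode x} (proj₁ (decode-~ origin x) v₀x)
        (_◅_ {j = decode y} (proj₁ (decode-~ x y) xy)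
          (proj₁ (decode-~ y (encode w′)) yw ◅ ε))
  in subst₂ (Star _~_) αv₀≡u (trans (cong (proj₁ α) (decode-encode w′)) (inverseʳ α w))
       (gmap (proj₁ α) (λ {s} {t} → proj₁ (proj₂ (proj₂ (proj₂ α)) s t)) walk)

K4-connected : Connected K4
K4-connected x y with x F.≟ y
... | yes refl = ε
... | no x≢y = x≢y ◅ ε

K4-regular : Regular K4
K4-regular = 3 , λ x →
  (λ i → punchIn x i , F.punchInᵢ≢i x i ∘ sym) , F.punchIn-injective x ,
  λ (y , x≢y) → punchOut x≢y , sym (F.punchIn-punchOut x≢y)

K222-connected : Connected K222
K222-connected (a , e) (b , f) with a F.≟ b
... | yes refl = _◅_ {j = punchIn a zero , zero}
  (F.punchInᵢ≢i a zero ∘ sym) (F.punchInᵢ≢i a zero ◅ ε)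
... | no a≢b = a≢b ◅ ε

K222-regular : Regular K222
K222-regular = 4 , λ (a , e) → HasCard-image (λ s t → proj₁ s ≡ proj₁ t)
  (HasCard-× (HasCard-Fin 2) (HasCard-Fin 2))
  (λ (i , f) → (punchIn a i , f) , F.punchInᵢ≢i a i ∘ sym)
  (λ (i , f) (j , g) eq →
    cong₂ _,_ (F.punchIn-injective a i j (cong proj₁ eq)) (cong proj₂ eq))
  (λ ((b , f) , a≢b) → (punchOut a≢b , f) , cong (_, f) (sym (F.punchIn-punchOut a≢b)))

theorem5p1 : IsHGraph K4 G 42 4 × IsHGraph K222 G 21 3 ×
    Ultrahomogeneous K4 G × Ultrahomogeneous K222 G ×
    Fastened K4 K222 G ×
    ¬ LineGraphical K4 4 3 ×
    HasCard (Aut G) (_≈Aut_ G) 1008 ×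
    HasCard (Edge G) (SameEdge G) 252 × 1008 ≡ 4 * 252 ×
    EdgeTransitive G ×
    (∀ e → HasCard (EdgeStabilizer G e) (λ s t → _≈Aut_ G (proj₁ s) (proj₁ t)) 4) ×
    VertexTransitive G ×
    (∀ v → HasCard (VertexStabilizer G v) (λ s t → _≈Aut_ G (proj₁ s) (proj₁ t)) 24)
theorem5p1 =
  K4-copies.isHGraph K4-connected K4-regular (toWitness {a? = 1 ℕ.<? 4} _)
    (toWitness {a? = 4 ℕ.<? 42} _) G-connected ,
  K222-copies.isHGraph K222-connected K222-regular (toWitness {a? = 1 ℕ.<? 3} _)
    (toWitness {a? = 3 ℕ.<? 21} _) G-connected ,
  K4-model.ultrahomogeneous , K222-model.ultrahomogeneous ,
  (λ u w uw → K4-copies.numCopiesAtEdge u w uw , K222-copies.numCopiesAtEdge u w uw) ,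
  -- The minimum of 4 and 3 is 3, which differs from 4.
  (λ { (() , _) }) ,
  Aut-card , Edge-card , refl , edgeTransitive , edgeStabiliser-card ,
  vertexTransitive , vertexStabiliser-card
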